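{- Let $n,B,k\in\mathbb{N}$ with $k\ge2$ and $B\le n/k$, and let $f_j=1/j$ for $j\in[n]$. Let $h_1,\dots,h_k:[n]\to[B]$ be independent, truly (uniformly) random hash functions. For $i\in[n]$ define $$\tilde f_i=\min_{\ell\in[k]}\left(\sum_{j\in[n]}[h_\ell(j)=h_\ell(i)]\,f_j\right).$$ Then for any $i\in[n]$, $$\mathbb{E}[|\tilde f_i-f_i|]=\Theta\left(\frac{\log(n/B)}{B}\right),$$ where the implied constants are absolute.
   Context: $[E]$ denotes the indicator of the event $E$ (equal to $1$ if $E$ holds and $0$ otherwise). -}

module Defs where

open import Data.Nat as ℕ using (ℕ; zero; suc)
open import Data.Nat.DivMod as ℕD using ()
open import Data.Nat.Logarithm using (⌊log₂_⌋)
open import Data.Integer using (+_)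
open import Data.Fin using (Fin; toℕ)
open import Data.Fin.Properties using (_≟_)
open import Data.Vec using (Vec; []; _∷_; lookup)
import Data.Vec
import Data.Rational
open import Data.List using (List; []; _∷_; map; concatMap; length; allFin)
open import Data.Rational using (ℚ; 0ℚ; _+_; _-_; _⊓_; ∣_∣; _/_)
open import Relation.Nullary using (yes; no)

-- f_j = 1/j for j ∈ [n] = {1,…,n}; the index j : Fin n represents j = toℕ j + 1.
f : ∀ {n} → Fin n → ℚ
f j = + 1 / suc (toℕ j)

Hash : ℕ → ℕ → Set
Hash n B = Vec (Fin B) n

allVecs : ∀ {A : Set} → List A → ∀ m → List (Vec A m)
allVecs xs zero = [] ∷ []
allVecs xs (suc m) = concatMap (λ x → map (x ∷_) (allVecs xs m)) xs

-- the sample space: all k-tuples (h_1,…,h_k) of functions [n] → [B]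
-- (uniform product measure = uniform distribution over this list)
allHashTuples : ∀ n B k → List (Vec (Hash n B) k)
allHashTuples n B k = allVecs (allVecs (allFin B) n) k

bucketSum : ∀ {n B} → Hash n B → Fin n → ℚ
bucketSum {n} h i = go (allFin n)
  where
  go : List (Fin n) → ℚ
  go [] = 0ℚ
  go (j ∷ js) with lookup h j ≟ lookup h i
  ... | yes _ = f j + go js
  ... | no  _ = go js

-- minimum over a vector, nonempty case; (empty vector ↦ 0, never used since k ≥ 2)
minVec : ∀ {k} → Vec ℚ k → ℚ
minVec [] = 0ℚ
minVec (x ∷ []) = x
minVec (x ∷ y ∷ ys) = x ⊓ minVec (y ∷ ys)

ftilde : ∀ {n B k} → Vec (Hash n B) k → Fin n → ℚ
ftilde hs i = minVec (Data.Vec.map (λ h → bucketSum h i) hs)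

sumℚ : List ℚ → ℚ
sumℚ [] = 0ℚ
sumℚ (x ∷ xs) = x + sumℚ xs

uniformMean : List ℚ → ℚ
uniformMean [] = 0ℚ
uniformMean (x ∷ xs) = (sumℚ (x ∷ xs)) Data.Rational.* (+ 1 / suc (length xs))

expectedError : ∀ n B k → Fin n → ℚ
expectedError n B k i =
  uniformMean (map (λ hs → ∣ ftilde hs i - f i ∣) (allHashTuples n B k))

-- the comparison quantity log(n/B)/B, with log(n/B) measured as ⌊log₂ ⌊n/B⌋⌋
-- (within absolute constant factors of ln(n/B) since n/B ≥ k ≥ 2); B = 0 ↦ 0 (excluded)
logRatioOverB : ℕ → ℕ → ℚ
logRatioOverB n zero = 0ℚ
logRatioOverB n (suc b) = + ⌊log₂ (n ℕD./ suc b) ⌋ / suc b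

{-# OPTIONS --safe #-}
-- With a_j the indicator of j ≠ i colliding with i, a row errs by X = ∑ a_j / j; a'_l belongs to a second row.
--
-- Upper bound: split X into the contributions of j ≤ B and of j > B. The second part has mean O(log (n/B) / B).
-- For the first, min is subadditive in each argument on nonnegative numbers, so that
-- min (∑ a_j / j) (∑ a'_l / l) ≤ ∑ a_j a'_l min (1/j) (1/l), whose mean is B⁻² ∑_{j,l ≤ B} 1 / max j l ≤ 2/B.
--
-- Lower bound: X dominates half of ∑_u C(2ᵘD) / (2ᵘD), where C(D) counts the hits among the D smallest indices.
-- Pointwise C ≥ r − 2^(r − C), and 2^(−C) has mean at most (1 − 1/2B)^(D−1). For D = 4rB with r above log₂ k the
-- defects are so small that their sum over all k rows stays below half of the main term, leaving a constant
-- multiple of 1/B for each of the order of log (n/B) dyadic scales. When n/B is bounded, X ≥ 1/n unless i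
-- collides with nothing, and k times the probability of that is at most 2/3.
module Submission where

open import Defs
open import Data.Nat using (ℕ; _≤_; _*_)
open import Data.Fin using (Fin)
open import Data.Product using (Σ; _×_)
open import Data.Rational using (ℚ; 0ℚ) renaming (_<_ to _<ℚ_; _≤_ to _≤ℚ_; _*_ to _*ℚ_)

open import Data.Bool using (Bool; true; false; if_then_else_; _∧_; not; T)
open import Data.Bool.Properties using (∧-identityʳ)
open import Data.Empty using (⊥-elim)
open import Data.Fin using (zero; suc; toℕ)
import Data.Fin.Properties as FP
import Data.Integer as ℤ
import Data.Integer.Properties as ℤP
open import Data.List using (List; []; _∷_; _++_; map; concatMap; length; allFin; tabulate)
import Data.List.Properties as LP
open import Data.Nat as ℕ using (zero; suc; NonZero; z≤n; s≤s)
open import Data.Nat.DivMod using (m≡m%n+[m/n]*n; m%n<n; m/n*n≤m; m*n/n≡m; /-monoˡ-≤)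
open import Data.Nat.Logarithm using (⌊log₂_⌋; ⌊log₂⌋-mono-≤; ⌊log₂⌊n/2⌋⌋≡⌊log₂n⌋∸1; ⌊log₂[2^n]⌋≡n)
import Data.Nat.Properties as ℕP
open import Data.Product using (_,_)
open import Data.Rational using (1ℚ; ½; _+_; _-_; -_; _⊓_; ∣_∣; _/_)
import Data.Rational as ℚ
import Data.Rational.Properties as ℚP
open import Data.Rational.Solver using (module +-*-Solver)
import Data.Rational.Unnormalised as ℚᵘ
import Data.Rational.Unnormalised.Properties as ℚᵘP
open import Data.Sum using (inj₁; inj₂; [_,_]′)
open import Data.Vec using (Vec; []; _∷_; lookup; _[_]≔_)
open import Data.Vec.Properties using (lookup∘update; lookup∘update′)
open import Function using (_∘_; id)
open import Relation.Binary.PropositionalEquality using (_≡_; refl; sym; trans; cong; cong₂; subst)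
open import Relation.Nullary using (yes; no; does)
open import Relation.Nullary.Decidable using (dec-true; from-yes)
open import Algebra.Bundles using (CommutativeRing)
import Algebra.Properties.Semiring.Mult (CommutativeRing.semiring ℚP.+-*-commutativeRing) as Mult
open import Algebra.Properties.Semiring.Exp (CommutativeRing.semiring ℚP.+-*-commutativeRing) using (^-homo-*; ^-assocʳ) renaming (_^_ to _^ℚ_)
open import Algebra.Properties.Semiring.Sum (CommutativeRing.semiring ℚP.+-*-commutativeRing) using (sum; sum-cong-≗; ∑-distrib-+; ∑-comm; *-distribˡ-sum; *-distribʳ-sum)
open import Algebra.Properties.Monoid.Sum ℚP.*-1-monoid using () renaming (sum to product; sum-cong-≗ to product-cong-≗)

open +-*-Solver using (solve; _:+_; _:*_; _:-_; :-_; _:=_; con)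
open ℚP.≤-Reasoning

-- Order and ring facts in ℚ

-- Both bounds must be uniform in `k`, and this shapes the proof. From above, one row is not enough:
-- the indices up to `B` alone have mean of order `log B / B`, which can dwarf `log (n/B) / B`. Two
-- independent rows remove it, and `k ≥ 2` makes `log₂ (n/B)` at least 1, which absorbs the
-- remaining `2/B`. From below, the union bound loses a factor `k`, which may be as large as `n/B`.
-- Hence `r` has to start near `L = ⌊log₂ (n/B)⌋`, and the first prefix has size about `4LB`.
-- Reaching it uses up only about `log L` of the `L` doublings between `B` and `n`; for simplicity
-- half of them are given away, which is affordable from `L = 12` on. Probabilities are computed by
-- redrawing the bucket of `i` first: with that bucket fixed, hits of different indices are
-- independent. Everything stays in ℚ: dyadic sums replace harmonic ones, and Bernoulli's inequality
-- replaces the exponential.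

0≤+ : ∀ {p q} → 0ℚ ≤ℚ p → 0ℚ ≤ℚ q → 0ℚ ≤ℚ p + q
0≤+ = ℚP.+-mono-≤

*-monoˡ : ∀ {r p q} → 0ℚ ≤ℚ r → p ≤ℚ q → r *ℚ p ≤ℚ r *ℚ q
*-monoˡ {r} 0≤r = ℚP.*-monoˡ-≤-nonNeg r {{ℚ.nonNegative 0≤r}}

*-monoʳ : ∀ {r p q} → 0ℚ ≤ℚ r → p ≤ℚ q → p *ℚ r ≤ℚ q *ℚ r
*-monoʳ {r} 0≤r = ℚP.*-monoʳ-≤-nonNeg r {{ℚ.nonNegative 0≤r}}

*-mono : ∀ {p q r s} → 0ℚ ≤ℚ r → 0ℚ ≤ℚ q → p ≤ℚ q → r ≤ℚ s → p *ℚ r ≤ℚ q *ℚ s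
*-mono 0≤r 0≤q p≤q r≤s = ℚP.≤-trans (*-monoʳ 0≤r p≤q) (*-monoˡ 0≤q r≤s)

0≤* : ∀ {p q} → 0ℚ ≤ℚ p → 0ℚ ≤ℚ q → 0ℚ ≤ℚ p *ℚ q
0≤* {p} {q} 0≤p 0≤q = subst (_≤ℚ p *ℚ q) (ℚP.*-zeroʳ p) (*-monoˡ 0≤p 0≤q)

p≤p+q : ∀ {p q} → 0ℚ ≤ℚ q → p ≤ℚ p + q
p≤p+q {p} {q} 0≤q = subst (_≤ℚ p + q) (ℚP.+-identityʳ p) (ℚP.+-monoʳ-≤ p 0≤q)

p≤q+p : ∀ {p q} → 0ℚ ≤ℚ q → p ≤ℚ q + p
p≤q+p {p} {q} 0≤q = subst (_≤ℚ q + p) (ℚP.+-identityˡ p) (ℚP.+-monoˡ-≤ p 0≤q)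

≤+⇒-≤ : ∀ {p q r} → p ≤ℚ q + r → p - r ≤ℚ q
≤+⇒-≤ {p} {q} {r} p≤q+r = begin
  p - r       ≤⟨ ℚP.+-monoˡ-≤ (- r) p≤q+r ⟩
  q + r - r   ≡⟨ solve 2 (λ q r → q :+ r :- r := q) refl q r ⟩
  q           ∎


p≤q⇒0≤q-p : ∀ {p q} → p ≤ℚ q → 0ℚ ≤ℚ q - p
p≤q⇒0≤q-p {p} {q} p≤q = subst (_≤ℚ q - p) (ℚP.+-inverseʳ p) (ℚP.+-monoˡ-≤ (- p) p≤q)

p-q≤p : ∀ p {q} → 0ℚ ≤ℚ q → p - q ≤ℚ p
p-q≤p p {q} 0≤q = ≤+⇒-≤ {p} {p} {q} (p≤p+q 0≤q)

0≤1 : 0ℚ ≤ℚ 1ℚ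
0≤1 = ℚP.nonNegative⁻¹ 1ℚ

0≤½ : 0ℚ ≤ℚ ½
0≤½ = ℚP.nonNegative⁻¹ ½

½≤1 : ½ ≤ℚ 1ℚ
½≤1 = from-yes (½ ℚ.≤? 1ℚ)

-- As iterated addition, `ι (suc n)` unfolds to `1ℚ + ι n`, which suits both induction and the ring
-- solver.
ι : ℕ → ℚ
ι n = n Mult.× 1ℚ

ι-* : ∀ m n → ι (m * n) ≡ ι m *ℚ ι n
ι-* = Mult.×1-homo-*

0≤ι : ∀ n → 0ℚ ≤ℚ ι n
0≤ι zero    = ℚP.≤-refl
0≤ι (suc n) = 0≤+ 0≤1 (0≤ι n)

ι-mono : ∀ {m n} → m ≤ n → ι m ≤ℚ ι n
ι-mono {n = n} z≤n = 0≤ι n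
ι-mono (s≤s m≤n)   = ℚP.+-monoʳ-≤ 1ℚ (ι-mono m≤n)

-- The value 0 at 0 makes `recip` multiplicative on all of ℕ and gives the mean over an empty list
-- its value 0.
recip : ℕ → ℚ
recip zero    = 0ℚ
recip (suc n) = ℤ.+ 1 / suc n

-- Checked on unnormalised fractions, since the gcd inside `_/_` does not compute on variables.
suc/ : ∀ a b → ℤ.+ suc a / suc b ≡ recip (suc b) + ℤ.+ a / suc b
suc/ a b = ℚP.toℚᵘ-injective
  (ℚᵘP.≃-trans (ℚP.toℚᵘ-fromℚᵘ (ℚᵘ.mkℚᵘ (ℤ.+ suc a) b))
  (ℚᵘP.≃-trans same-denominator
  (ℚᵘP.≃-trans (ℚᵘP.+-cong (ℚᵘP.≃-sym (ℚP.toℚᵘ-fromℚᵘ (ℚᵘ.mkℚᵘ (ℤ.+ 1) b)))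
                            (ℚᵘP.≃-sym (ℚP.toℚᵘ-fromℚᵘ (ℚᵘ.mkℚᵘ (ℤ.+ a) b))))
               (ℚᵘP.≃-sym (ℚP.toℚᵘ-homo-+ (recip (suc b)) (ℤ.+ a / suc b))))))
  where
  same-denominator : ℚᵘ.mkℚᵘ (ℤ.+ suc a) b ℚᵘ.≃ ℚᵘ.mkℚᵘ (ℤ.+ 1) b ℚᵘ.+ ℚᵘ.mkℚᵘ (ℤ.+ a) b
  same-denominator = ℚᵘ.*≡* (trans (sym (ℤP.*-assoc (ℤ.+ suc a) (ℤ.+ suc b) (ℤ.+ suc b)))
    (cong (ℤ._* ℤ.+ suc b) (ℤP.*-distribʳ-+ (ℤ.+ suc b) (ℤ.+ 1) (ℤ.+ a))))

/≡ι*recip : ∀ a b → ℤ.+ a / suc b ≡ ι a *ℚ recip (suc b)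
/≡ι*recip zero b = trans (ℚP.fromℚᵘ-cong {ℚᵘ.mkℚᵘ (ℤ.+ 0) b} {ℚᵘ.mkℚᵘ (ℤ.+ 0) 0} (ℚᵘ.*≡* refl)) (sym (ℚP.*-zeroˡ (recip (suc b))))
/≡ι*recip (suc a) b = begin-equality
  ℤ.+ suc a / suc b                         ≡⟨ suc/ a b ⟩
  recip (suc b) + ℤ.+ a / suc b             ≡⟨ cong (recip (suc b) +_) (/≡ι*recip a b) ⟩
  recip (suc b) + ι a *ℚ recip (suc b)      ≡⟨ solve 2 (λ r a → r :+ a :* r := (con 1ℚ :+ a) :* r) refl (recip (suc b)) (ι a) ⟩
  ι (suc a) *ℚ recip (suc b)                ∎

ι*recip : ∀ n .{{_ : NonZero n}} → ι n *ℚ recip n ≡ 1ℚ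
ι*recip (suc n) = trans (sym (/≡ι*recip (suc n) n))
  (ℚP.fromℚᵘ-cong {ℚᵘ.mkℚᵘ (ℤ.+ suc n) n} {ℚᵘ.mkℚᵘ (ℤ.+ 1) 0} (ℚᵘ.*≡* (ℤP.*-comm (ℤ.+ suc n) (ℤ.+ 1))))

0≤recip : ∀ n → 0ℚ ≤ℚ recip n
0≤recip zero    = ℚP.≤-refl
0≤recip (suc n) = ℚP.nonNegative⁻¹ (recip (suc n)) {{ℚP.normalize-nonNeg 1 (suc n)}}

recip-unique : ∀ n {x} → ι n *ℚ x ≡ 1ℚ → x ≡ recip n
recip-unique zero    {x} eq with trans (sym (ℚP.*-zeroˡ x)) eq
... | ()
recip-unique n@(suc _) {x} eq = begin-equality
  x                           ≡⟨ ℚP.*-identityʳ x ⟨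
  x *ℚ 1ℚ                     ≡⟨ cong (x *ℚ_) (ι*recip n) ⟨
  x *ℚ (ι n *ℚ recip n)       ≡⟨ solve 3 (λ x n r → x :* (n :* r) := (n :* x) :* r) refl x (ι n) (recip n) ⟩
  (ι n *ℚ x) *ℚ recip n       ≡⟨ cong (_*ℚ recip n) eq ⟩
  1ℚ *ℚ recip n               ≡⟨ ℚP.*-identityˡ (recip n) ⟩
  recip n                     ∎

recip-* : ∀ m n → recip (m * n) ≡ recip m *ℚ recip n
recip-* zero n = sym (ℚP.*-zeroˡ (recip n))
recip-* m@(suc _) zero = trans (cong recip (ℕP.*-zeroʳ m)) (sym (ℚP.*-zeroʳ (recip m)))
recip-* m@(suc _) n@(suc _) = sym (recip-unique (m * n) (begin-equality
  ι (m * n) *ℚ (recip m *ℚ recip n)          ≡⟨ cong (_*ℚ (recip m *ℚ recip n)) (ι-* m n) ⟩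
  ι m *ℚ ι n *ℚ (recip m *ℚ recip n)         ≡⟨ solve 4 (λ a b c d → a :* b :* (c :* d) := (a :* c) :* (b :* d)) refl (ι m) (ι n) (recip m) (recip n) ⟩
  (ι m *ℚ recip m) *ℚ (ι n *ℚ recip n)       ≡⟨ cong₂ _*ℚ_ (ι*recip m) (ι*recip n) ⟩
  1ℚ                                         ∎))

recip-anti : ∀ {m n} .{{_ : NonZero m}} → m ≤ n → recip n ≤ℚ recip m
recip-anti {m} {zero}      m≤n = 0≤recip m
recip-anti {m} {n@(suc _)} m≤n = begin
  recip n                           ≡⟨ ℚP.*-identityˡ (recip n) ⟨
  1ℚ *ℚ recip n                     ≡⟨ cong (_*ℚ recip n) (ι*recip m) ⟨
  ι m *ℚ recip m *ℚ recip n         ≤⟨ *-monoʳ (0≤recip n) (*-monoʳ (0≤recip m) (ι-mono m≤n)) ⟩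
  ι n *ℚ recip m *ℚ recip n         ≡⟨ solve 3 (λ n m r → n :* m :* r := m :* (n :* r)) refl (ι n) (recip m) (recip n) ⟩
  recip m *ℚ (ι n *ℚ recip n)       ≡⟨ cong (recip m *ℚ_) (ι*recip n) ⟩
  recip m *ℚ 1ℚ                     ≡⟨ ℚP.*-identityʳ (recip m) ⟩
  recip m                           ∎

recip≤1 : ∀ n → recip n ≤ℚ 1ℚ
recip≤1 zero    = 0≤1
recip≤1 (suc n) = recip-anti {1} {suc n} (s≤s z≤n)

-- Powers

0≤^ : ∀ {x} n → 0ℚ ≤ℚ x → 0ℚ ≤ℚ x ^ℚ n
0≤^ zero    0≤x = 0≤1
0≤^ (suc n) 0≤x = 0≤* 0≤x (0≤^ n 0≤x)

^≤1 : ∀ {x} n → 0ℚ ≤ℚ x → x ≤ℚ 1ℚ → x ^ℚ n ≤ℚ 1ℚ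
^≤1 zero    0≤x x≤1 = ℚP.≤-refl
^≤1 (suc n) 0≤x x≤1 = *-mono (0≤^ n 0≤x) 0≤1 x≤1 (^≤1 n 0≤x x≤1)

^-anti : ∀ {x m n} → 0ℚ ≤ℚ x → x ≤ℚ 1ℚ → m ≤ n → x ^ℚ n ≤ℚ x ^ℚ m
^-anti {n = n} 0≤x x≤1 z≤n       = ^≤1 n 0≤x x≤1
^-anti         0≤x x≤1 (s≤s m≤n) = *-monoˡ 0≤x (^-anti 0≤x x≤1 m≤n)

^-monoˡ : ∀ {x y} n → 0ℚ ≤ℚ x → x ≤ℚ y → x ^ℚ n ≤ℚ y ^ℚ n
^-monoˡ zero    0≤x x≤y = ℚP.≤-refl
^-monoˡ (suc n) 0≤x x≤y = *-mono (0≤^ n 0≤x) (ℚP.≤-trans 0≤x x≤y) x≤y (^-monoˡ n 0≤x x≤y)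

^-distrib-* : ∀ x y n → (x *ℚ y) ^ℚ n ≡ x ^ℚ n *ℚ y ^ℚ n
^-distrib-* x y zero    = refl
^-distrib-* x y (suc n) = trans (cong (x *ℚ y *ℚ_) (^-distrib-* x y n))
  (solve 4 (λ x y a b → x :* y :* (a :* b) := (x :* a) :* (y :* b)) refl x y (x ^ℚ n) (y ^ℚ n))

ι-^ : ∀ m n → ι (m ℕ.^ n) ≡ ι m ^ℚ n
ι-^ m zero    = refl
ι-^ m (suc n) = trans (ι-* m (m ℕ.^ n)) (cong (ι m *ℚ_) (ι-^ m n))

2^*½^ : ∀ n → ι (2 ℕ.^ n) *ℚ ½ ^ℚ n ≡ 1ℚ
2^*½^ n = trans (cong (_*ℚ ½ ^ℚ n) (ι-^ 2 n)) (trans (sym (^-distrib-* (ι 2) ½ n)) (1^ n))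
  where
  1^ : ∀ n → 1ℚ ^ℚ n ≡ 1ℚ
  1^ zero    = refl
  1^ (suc n) = trans (ℚP.*-identityˡ (1ℚ ^ℚ n)) (1^ n)

-- Division-free form of `(1 − p)^m ≤ 1/(1 + mp)`. The induction rests on
-- `(1 − p)(1 + (m+1)p) + (m+1)p² = 1 + mp`.
bernoulli : ∀ {p} m → 0ℚ ≤ℚ p → p ≤ℚ 1ℚ → (1ℚ - p) ^ℚ m *ℚ (1ℚ + ι m *ℚ p) ≤ℚ 1ℚ
bernoulli {p} zero 0≤p p≤1 = ℚP.≤-reflexive (solve 1 (λ p → con 1ℚ :* (con 1ℚ :+ con 0ℚ :* p) := con 1ℚ) refl p)
bernoulli {p} (suc m) 0≤p p≤1 = begin
  x *ℚ y *ℚ (1ℚ + (1ℚ + ι m) *ℚ p)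
    ≤⟨ p≤p+q (0≤* (0≤^ m 0≤x) (0≤* (0≤+ 0≤1 (0≤ι m)) (0≤* 0≤p 0≤p))) ⟩
  x *ℚ y *ℚ (1ℚ + (1ℚ + ι m) *ℚ p) + y *ℚ ((1ℚ + ι m) *ℚ (p *ℚ p))
    ≡⟨ solve 3 (λ p y m → (con 1ℚ :- p) :* y :* (con 1ℚ :+ (con 1ℚ :+ m) :* p) :+ y :* ((con 1ℚ :+ m) :* (p :* p))
                        := y :* (con 1ℚ :+ m :* p)) refl p y (ι m) ⟩
  y *ℚ (1ℚ + ι m *ℚ p)
    ≤⟨ bernoulli m 0≤p p≤1 ⟩
  1ℚ ∎
  where
  x = 1ℚ - p
  y = x ^ℚ m
  0≤x : 0ℚ ≤ℚ x
  0≤x = p≤q⇒0≤q-p p≤1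

-- Expectation over a uniform list

private variable
  A : Set

sumOver : List A → (A → ℚ) → ℚ
sumOver xs φ = sumℚ (map φ xs)

sumOver-cong : ∀ (xs : List A) {φ ψ : A → ℚ} → (∀ x → φ x ≡ ψ x) → sumOver xs φ ≡ sumOver xs ψ
sumOver-cong xs eq = cong sumℚ (LP.map-cong eq xs)

sumOver-mono : ∀ (xs : List A) {φ ψ : A → ℚ} → (∀ x → φ x ≤ℚ ψ x) → sumOver xs φ ≤ℚ sumOver xs ψ
sumOver-mono []       le = ℚP.≤-refl
sumOver-mono (x ∷ xs) le = ℚP.+-mono-≤ (le x) (sumOver-mono xs le)

sumOver-+ : ∀ (xs : List A) (φ ψ : A → ℚ) → sumOver xs (λ x → φ x + ψ x) ≡ sumOver xs φ + sumOver xs ψ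
sumOver-+ []       φ ψ = refl
sumOver-+ (x ∷ xs) φ ψ = trans (cong (φ x + ψ x +_) (sumOver-+ xs φ ψ))
  (solve 4 (λ a b c d → a :+ b :+ (c :+ d) := (a :+ c) :+ (b :+ d)) refl (φ x) (ψ x) (sumOver xs φ) (sumOver xs ψ))

sumOver-* : ∀ (xs : List A) c (φ : A → ℚ) → sumOver xs (λ x → c *ℚ φ x) ≡ c *ℚ sumOver xs φ
sumOver-* []       c φ = sym (ℚP.*-zeroʳ c)
sumOver-* (x ∷ xs) c φ = trans (cong (c *ℚ φ x +_) (sumOver-* xs c φ)) (sym (ℚP.*-distribˡ-+ c (φ x) (sumOver xs φ)))

sumOver-const : ∀ (xs : List A) c → sumOver xs (λ _ → c) ≡ ι (length xs) *ℚ c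
sumOver-const []       c = sym (ℚP.*-zeroˡ c)
sumOver-const (x ∷ xs) c = trans (cong (c +_) (sumOver-const xs c))
  (solve 2 (λ c l → c :+ l :* c := (con 1ℚ :+ l) :* c) refl c (ι (length xs)))

sumOver-++ : ∀ (xs ys : List A) (φ : A → ℚ) → sumOver (xs ++ ys) φ ≡ sumOver xs φ + sumOver ys φ
sumOver-++ []       ys φ = sym (ℚP.+-identityˡ (sumOver ys φ))
sumOver-++ (x ∷ xs) ys φ = trans (cong (φ x +_) (sumOver-++ xs ys φ)) (sym (ℚP.+-assoc (φ x) (sumOver xs φ) (sumOver ys φ)))

sumOver-swap : ∀ {B : Set} (xs : List A) (ys : List B) (φ : A → B → ℚ) →
               sumOver xs (λ x → sumOver ys (φ x)) ≡ sumOver ys (λ y → sumOver xs (λ x → φ x y))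
sumOver-swap []       ys φ = sym (trans (sumOver-const ys 0ℚ) (ℚP.*-zeroʳ (ι (length ys))))
sumOver-swap (x ∷ xs) ys φ = trans (cong (sumOver ys (φ x) +_) (sumOver-swap xs ys φ))
  (sym (sumOver-+ ys (φ x) (λ y → sumOver xs (λ x′ → φ x′ y))))

sumOver-tabulate : ∀ {n} (g : Fin n → A) φ → sumOver (tabulate g) φ ≡ sum (φ ∘ g)
sumOver-tabulate {n = zero}  g φ = refl
sumOver-tabulate {n = suc n} g φ = cong (φ (g zero) +_) (sumOver-tabulate (g ∘ suc) φ)

𝔼 : List A → (A → ℚ) → ℚ
𝔼 xs φ = uniformMean (map φ xs)

𝔼≡sumOver : ∀ (xs : List A) φ → 𝔼 xs φ ≡ recip (length xs) *ℚ sumOver xs φ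
𝔼≡sumOver []       φ = refl
𝔼≡sumOver (x ∷ xs) φ = trans (cong (λ l → sumOver (x ∷ xs) φ *ℚ recip (suc l)) (LP.length-map φ xs))
  (ℚP.*-comm (sumOver (x ∷ xs) φ) (recip (suc (length xs))))

𝔼-cong : ∀ (xs : List A) {φ ψ : A → ℚ} → (∀ x → φ x ≡ ψ x) → 𝔼 xs φ ≡ 𝔼 xs ψ
𝔼-cong xs eq = cong uniformMean (LP.map-cong eq xs)

𝔼-mono : ∀ (xs : List A) {φ ψ : A → ℚ} → (∀ x → φ x ≤ℚ ψ x) → 𝔼 xs φ ≤ℚ 𝔼 xs ψ
𝔼-mono xs {φ} {ψ} le = begin
  𝔼 xs φ                                 ≡⟨ 𝔼≡sumOver xs φ ⟩
  recip (length xs) *ℚ sumOver xs φ      ≤⟨ *-monoˡ (0≤recip (length xs)) (sumOver-mono xs le) ⟩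
  recip (length xs) *ℚ sumOver xs ψ      ≡⟨ 𝔼≡sumOver xs ψ ⟨
  𝔼 xs ψ                                 ∎

𝔼-+ : ∀ (xs : List A) φ ψ → 𝔼 xs (λ x → φ x + ψ x) ≡ 𝔼 xs φ + 𝔼 xs ψ
𝔼-+ xs φ ψ = begin-equality
  𝔼 xs (λ x → φ x + ψ x)                       ≡⟨ 𝔼≡sumOver xs _ ⟩
  r *ℚ sumOver xs (λ x → φ x + ψ x)            ≡⟨ cong (r *ℚ_) (sumOver-+ xs φ ψ) ⟩
  r *ℚ (sumOver xs φ + sumOver xs ψ)           ≡⟨ ℚP.*-distribˡ-+ r (sumOver xs φ) (sumOver xs ψ) ⟩
  r *ℚ sumOver xs φ + r *ℚ sumOver xs ψ        ≡⟨ cong₂ _+_ (𝔼≡sumOver xs φ) (𝔼≡sumOver xs ψ) ⟨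
  𝔼 xs φ + 𝔼 xs ψ                              ∎
  where r = recip (length xs)

𝔼-* : ∀ (xs : List A) c φ → 𝔼 xs (λ x → c *ℚ φ x) ≡ c *ℚ 𝔼 xs φ
𝔼-* xs c φ = begin-equality
  𝔼 xs (λ x → c *ℚ φ x)               ≡⟨ 𝔼≡sumOver xs _ ⟩
  r *ℚ sumOver xs (λ x → c *ℚ φ x)    ≡⟨ cong (r *ℚ_) (sumOver-* xs c φ) ⟩
  r *ℚ (c *ℚ sumOver xs φ)            ≡⟨ solve 3 (λ r c s → r :* (c :* s) := c :* (r :* s)) refl r c (sumOver xs φ) ⟩
  c *ℚ (r *ℚ sumOver xs φ)            ≡⟨ cong (c *ℚ_) (𝔼≡sumOver xs φ) ⟨
  c *ℚ 𝔼 xs φ                         ∎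
  where r = recip (length xs)

𝔼-*ʳ : ∀ (xs : List A) c φ → 𝔼 xs (λ x → φ x *ℚ c) ≡ 𝔼 xs φ *ℚ c
𝔼-*ʳ xs c φ = trans (𝔼-cong xs (λ x → ℚP.*-comm (φ x) c)) (trans (𝔼-* xs c φ) (ℚP.*-comm c (𝔼 xs φ)))

𝔼-const : ∀ (xs : List A) .{{_ : NonZero (length xs)}} c → 𝔼 xs (λ _ → c) ≡ c
𝔼-const xs c = begin-equality
  𝔼 xs (λ _ → c)                                ≡⟨ 𝔼≡sumOver xs _ ⟩
  recip (length xs) *ℚ sumOver xs (λ _ → c)     ≡⟨ cong (recip (length xs) *ℚ_) (sumOver-const xs c) ⟩
  recip (length xs) *ℚ (ι (length xs) *ℚ c)     ≡⟨ solve 3 (λ r l c → r :* (l :* c) := l :* r :* c) refl (recip (length xs)) (ι (length xs)) c ⟩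
  ι (length xs) *ℚ recip (length xs) *ℚ c       ≡⟨ cong (_*ℚ c) (ι*recip (length xs)) ⟩
  1ℚ *ℚ c                                       ≡⟨ ℚP.*-identityˡ c ⟩
  c                                             ∎

𝔼-swap : ∀ {B : Set} (xs : List A) (ys : List B) (φ : A → B → ℚ) →
         𝔼 xs (λ x → 𝔼 ys (φ x)) ≡ 𝔼 ys (λ y → 𝔼 xs (λ x → φ x y))
𝔼-swap xs ys φ = begin-equality
  𝔼 xs (λ x → 𝔼 ys (φ x))
    ≡⟨ nested xs ys φ ⟩
  rx *ℚ (ry *ℚ sumOver xs (λ x → sumOver ys (φ x)))
    ≡⟨ cong (λ s → rx *ℚ (ry *ℚ s)) (sumOver-swap xs ys φ) ⟩
  rx *ℚ (ry *ℚ sumOver ys (λ y → sumOver xs (λ x → φ x y)))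
    ≡⟨ solve 3 (λ a b c → a :* (b :* c) := b :* (a :* c)) refl rx ry (sumOver ys (λ y → sumOver xs (λ x → φ x y))) ⟩
  ry *ℚ (rx *ℚ sumOver ys (λ y → sumOver xs (λ x → φ x y)))
    ≡⟨ nested ys xs (λ y x → φ x y) ⟨
  𝔼 ys (λ y → 𝔼 xs (λ x → φ x y)) ∎
  where
  rx = recip (length xs)
  ry = recip (length ys)
  nested : ∀ {A B : Set} (xs : List A) (ys : List B) (φ : A → B → ℚ) →
           𝔼 xs (λ x → 𝔼 ys (φ x)) ≡ recip (length xs) *ℚ (recip (length ys) *ℚ sumOver xs (λ x → sumOver ys (φ x)))
  nested xs ys φ = trans (𝔼≡sumOver xs _) (cong (recip (length xs) *ℚ_)
    (trans (sumOver-cong xs (λ x → 𝔼≡sumOver ys (φ x))) (sumOver-* xs (recip (length ys)) (λ x → sumOver ys (φ x)))))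

𝔼-sum : ∀ (xs : List A) {n} (φ : Fin n → A → ℚ) → 𝔼 xs (λ x → sum (λ j → φ j x)) ≡ sum (λ j → 𝔼 xs (φ j))
𝔼-sum xs {zero}  φ = trans (𝔼-* xs 0ℚ (λ _ → 0ℚ)) (ℚP.*-zeroˡ (𝔼 xs (λ _ → 0ℚ)))
𝔼-sum xs {suc n} φ = trans (𝔼-+ xs (φ zero) (λ x → sum (λ j → φ (suc j) x))) (cong (𝔼 xs (φ zero) +_) (𝔼-sum xs (φ ∘ suc)))

-- The product measure: independence, marginals, resampling

module _ (xs : List A) where

  prepend-all : ∀ {m} (ys : List A) (V : List (Vec A m)) φ →
                sumOver (concatMap (λ x → map (x ∷_) V) ys) φ ≡ sumOver ys (λ x → sumOver V (λ v → φ (x ∷ v)))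
  prepend-all []       V φ = refl
  prepend-all (y ∷ ys) V φ = trans (sumOver-++ (map (y ∷_) V) _ φ)
    (cong₂ _+_ (cong sumℚ (sym (LP.map-∘ V))) (prepend-all ys V φ))

  length-prepend-all : ∀ {m} (ys : List A) (V : List (Vec A m)) →
                       length (concatMap (λ x → map (x ∷_) V) ys) ≡ length ys * length V
  length-prepend-all []       V = refl
  length-prepend-all (y ∷ ys) V = trans (LP.length-++ (map (y ∷_) V))
    (cong₂ ℕ._+_ (LP.length-map (y ∷_) V) (length-prepend-all ys V))

  allVecs-nonempty : .{{_ : NonZero (length xs)}} → ∀ m → NonZero (length (allVecs xs m))
  allVecs-nonempty zero    = _
  allVecs-nonempty (suc m) = subst NonZero (sym (length-prepend-all xs (allVecs xs m)))
    (ℕP.m*n≢0 (length xs) (length (allVecs xs m)) {{it}} {{allVecs-nonempty m}})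
    where
    it : {{NonZero (length xs)}} → NonZero (length xs)
    it {{p}} = p

  𝔼-∷ : ∀ m φ → 𝔼 (allVecs xs (suc m)) φ ≡ 𝔼 xs (λ x → 𝔼 (allVecs xs m) (λ v → φ (x ∷ v)))
  𝔼-∷ m φ = begin-equality
    𝔼 (allVecs xs (suc m)) φ
      ≡⟨ 𝔼≡sumOver (allVecs xs (suc m)) φ ⟩
    recip (length (allVecs xs (suc m))) *ℚ sumOver (allVecs xs (suc m)) φ
      ≡⟨ cong₂ _*ℚ_ (trans (cong recip (length-prepend-all xs V)) (recip-* (length xs) (length V))) (prepend-all xs V φ) ⟩
    recip (length xs) *ℚ recip (length V) *ℚ sumOver xs (λ x → sumOver V (λ v → φ (x ∷ v)))
      ≡⟨ ℚP.*-assoc (recip (length xs)) (recip (length V)) _ ⟩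
    recip (length xs) *ℚ (recip (length V) *ℚ sumOver xs (λ x → sumOver V (λ v → φ (x ∷ v))))
      ≡⟨ cong (recip (length xs) *ℚ_) (sumOver-* xs (recip (length V)) (λ x → sumOver V (λ v → φ (x ∷ v)))) ⟨
    recip (length xs) *ℚ sumOver xs (λ x → recip (length V) *ℚ sumOver V (λ v → φ (x ∷ v)))
      ≡⟨ cong (recip (length xs) *ℚ_) (sumOver-cong xs (λ x → 𝔼≡sumOver V (λ v → φ (x ∷ v)))) ⟨
    recip (length xs) *ℚ sumOver xs (λ x → 𝔼 V (λ v → φ (x ∷ v)))
      ≡⟨ 𝔼≡sumOver xs _ ⟨
    𝔼 xs (λ x → 𝔼 V (λ v → φ (x ∷ v))) ∎
    where V = allVecs xs m

  -- The first coordinate is averaged separately and its factor pulled out of the inner mean; this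
  -- is the independence of the values of one hash function.
  𝔼-product : ∀ m (g : Fin m → A → ℚ) →
              𝔼 (allVecs xs m) (λ v → product (λ j → g j (lookup v j))) ≡ product (λ j → 𝔼 xs (g j))
  𝔼-product zero    g = refl
  𝔼-product (suc m) g = begin-equality
    𝔼 (allVecs xs (suc m)) (λ v → product (λ j → g j (lookup v j)))
      ≡⟨ 𝔼-∷ m _ ⟩
    𝔼 xs (λ x → 𝔼 (allVecs xs m) (λ v → g zero x *ℚ product (λ j → g (suc j) (lookup v j))))
      ≡⟨ 𝔼-cong xs (λ x → trans (𝔼-* (allVecs xs m) (g zero x) _) (cong (g zero x *ℚ_) (𝔼-product m (g ∘ suc)))) ⟩
    𝔼 xs (λ x → g zero x *ℚ product (λ j → 𝔼 xs (g (suc j))))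
      ≡⟨ 𝔼-*ʳ xs _ (g zero) ⟩
    𝔼 xs (g zero) *ℚ product (λ j → 𝔼 xs (g (suc j))) ∎

  module _ .{{nonempty : NonZero (length xs)}} where

    𝔼-marginal : ∀ m (j : Fin m) φ → 𝔼 (allVecs xs m) (λ v → φ (lookup v j)) ≡ 𝔼 xs φ
    𝔼-marginal (suc m) zero    φ = trans (𝔼-∷ m _)
      (𝔼-cong xs (λ x → 𝔼-const (allVecs xs m) {{allVecs-nonempty m}} (φ x)))
    𝔼-marginal (suc m) (suc j) φ = trans (𝔼-∷ m _)
      (trans (𝔼-cong xs (λ x → 𝔼-marginal m j φ)) (𝔼-const xs (𝔼 xs φ)))

    -- Overwriting a coordinate by a fresh draw preserves the law. Applied to the queried item it
    -- conditions on that item's bucket `b`: a hit of `j` then means `h(j) = b`, an event of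
    -- coordinate `j` alone.
    𝔼-resample : ∀ m (i : Fin m) φ →
                 𝔼 (allVecs xs m) φ ≡ 𝔼 xs (λ b → 𝔼 (allVecs xs m) (λ v → φ (v [ i ]≔ b)))
    𝔼-resample (suc m) zero φ = begin-equality
      𝔼 (allVecs xs (suc m)) φ
        ≡⟨ 𝔼-∷ m φ ⟩
      𝔼 xs (λ b → 𝔼 (allVecs xs m) (λ v → φ (b ∷ v)))
        ≡⟨ 𝔼-cong xs (λ b → 𝔼-const xs _) ⟨
      𝔼 xs (λ b → 𝔼 xs (λ _ → 𝔼 (allVecs xs m) (λ v → φ (b ∷ v))))
        ≡⟨ 𝔼-cong xs (λ b → 𝔼-∷ m (λ v → φ (v [ zero ]≔ b))) ⟨
      𝔼 xs (λ b → 𝔼 (allVecs xs (suc m)) (λ v → φ (v [ zero ]≔ b))) ∎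
    𝔼-resample (suc m) (suc i) φ = begin-equality
      𝔼 (allVecs xs (suc m)) φ
        ≡⟨ 𝔼-∷ m φ ⟩
      𝔼 xs (λ x → 𝔼 (allVecs xs m) (λ v → φ (x ∷ v)))
        ≡⟨ 𝔼-cong xs (λ x → 𝔼-resample m i (λ v → φ (x ∷ v))) ⟩
      𝔼 xs (λ x → 𝔼 xs (λ b → 𝔼 (allVecs xs m) (λ v → φ (x ∷ v [ i ]≔ b))))
        ≡⟨ 𝔼-swap xs xs _ ⟩
      𝔼 xs (λ b → 𝔼 xs (λ x → 𝔼 (allVecs xs m) (λ v → φ (x ∷ v [ i ]≔ b))))
        ≡⟨ 𝔼-cong xs (λ b → 𝔼-∷ m (λ v → φ (v [ suc i ]≔ b))) ⟨
      𝔼 xs (λ b → 𝔼 (allVecs xs (suc m)) (λ v → φ (v [ suc i ]≔ b))) ∎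

-- Collision indicators and the error of one row

⟦_⟧ : Bool → ℚ
⟦ b ⟧ = if b then 1ℚ else 0ℚ

collides : ∀ {n B} → Hash n B → Fin n → Fin n → Bool
collides h i j = does (lookup h j FP.≟ lookup h i)

mutual
  -- The summation loop of bucketSum is local to it and has no name; the wildcard stands for that loop run on js.
  bucketLoop≡sumOver : ∀ {n B} (h : Hash n B) i js → _ ≡ sumOver js (λ j → ⟦ collides h i j ⟧ *ℚ f j)

  bucketSum≡sumOver : ∀ {n B} (h : Hash n B) i → bucketSum h i ≡ sumOver (allFin n) (λ j → ⟦ collides h i j ⟧ *ℚ f j)
  -- Turning `allFin n` into a variable makes the goal an instance of the loop lemma on an arbitrary
  -- list, which determines the wildcard.
  bucketSum≡sumOver {n} h i with allFin n
  ... | js = bucketLoop≡sumOver h i js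

  bucketLoop≡sumOver h i [] = refl
  bucketLoop≡sumOver h i (j ∷ js) with lookup h j FP.≟ lookup h i
  ... | yes _ = cong₂ _+_ (sym (ℚP.*-identityˡ (f j))) (bucketLoop≡sumOver h i js)
  ... | no  _ = trans (bucketLoop≡sumOver h i js)
    (sym (trans (cong (_+ _) (ℚP.*-zeroˡ (f j))) (ℚP.+-identityˡ _)))

sum-mono : ∀ {n} {φ ψ : Fin n → ℚ} → (∀ j → φ j ≤ℚ ψ j) → sum φ ≤ℚ sum ψ
sum-mono {zero}  le = ℚP.≤-refl
sum-mono {suc n} le = ℚP.+-mono-≤ (le zero) (sum-mono (le ∘ suc))

sum-const : ∀ n c → sum {n} (λ _ → c) ≡ ι n *ℚ c
sum-const zero    c = sym (ℚP.*-zeroˡ c)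
sum-const (suc n) c = trans (cong (c +_) (sum-const n c))
  (solve 2 (λ c l → c :+ l :* c := (con 1ℚ :+ l) :* c) refl c (ι n))

0≤sum : ∀ {n} {φ : Fin n → ℚ} → (∀ j → 0ℚ ≤ℚ φ j) → 0ℚ ≤ℚ sum φ
0≤sum {zero}  0≤φ = ℚP.≤-refl
0≤sum {suc n} 0≤φ = 0≤+ (0≤φ zero) (0≤sum (0≤φ ∘ suc))

sum-select : ∀ {n} (i : Fin n) (g : Fin n → ℚ) → sum (λ j → ⟦ does (j FP.≟ i) ⟧ *ℚ g j) ≡ g i
sum-select {suc n} zero g = trans
  (cong₂ _+_ (ℚP.*-identityˡ (g zero))
    (trans (sum-cong-≗ {n} {y = λ _ → 0ℚ} (λ j → ℚP.*-zeroˡ (g (suc j)))) (trans (sum-const n 0ℚ) (ℚP.*-zeroʳ (ι n)))))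
  (ℚP.+-identityʳ (g zero))
sum-select {suc n} (suc i) g = trans (cong₂ _+_ (ℚP.*-zeroˡ (g zero)) (sum-select i (g ∘ suc))) (ℚP.+-identityˡ (g (suc i)))

0≤⟦⟧ : ∀ b → 0ℚ ≤ℚ ⟦ b ⟧
0≤⟦⟧ true  = 0≤1
0≤⟦⟧ false = ℚP.≤-refl

⟦⟧*≤ : ∀ b {x} → 0ℚ ≤ℚ x → ⟦ b ⟧ *ℚ x ≤ℚ x
⟦⟧*≤ true  {x} 0≤x = ℚP.≤-reflexive (ℚP.*-identityˡ x)
⟦⟧*≤ false {x} 0≤x = subst (_≤ℚ x) (sym (ℚP.*-zeroˡ x)) 0≤x

0≤f : ∀ {n} (j : Fin n) → 0ℚ ≤ℚ f j
0≤f j = 0≤recip (suc (toℕ j))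

hit : ∀ {n B} → Fin n → Hash n B → Fin n → Bool
hit i h j = not (does (j FP.≟ i)) ∧ collides h i j

weightedHits : ∀ {n B} → Fin n → Hash n B → (Fin n → ℚ) → ℚ
weightedHits i h g = sum (λ j → ⟦ hit i h j ⟧ *ℚ g j)

load : ∀ {n B} → Fin n → Hash n B → ℚ
load i h = weightedHits i h f

0≤weightedHits : ∀ {n B} (i : Fin n) (h : Hash n B) {g} → (∀ j → 0ℚ ≤ℚ g j) → 0ℚ ≤ℚ weightedHits i h g
0≤weightedHits i h 0≤g = 0≤sum (λ j → 0≤* (0≤⟦⟧ (hit i h j)) (0≤g j))

weightedHits-mono : ∀ {n B} (i : Fin n) (h : Hash n B) {g g′} → (∀ j → g j ≤ℚ g′ j) → weightedHits i h g ≤ℚ weightedHits i h g′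
weightedHits-mono i h g≤g′ = sum-mono (λ j → *-monoˡ (0≤⟦⟧ (hit i h j)) (g≤g′ j))

weightedHits-+ : ∀ {n B} (i : Fin n) (h : Hash n B) g g′ →
                 weightedHits i h (λ j → g j + g′ j) ≡ weightedHits i h g + weightedHits i h g′
weightedHits-+ i h g g′ = trans (sum-cong-≗ (λ j → ℚP.*-distribˡ-+ ⟦ hit i h j ⟧ (g j) (g′ j)))
  (∑-distrib-+ (λ j → ⟦ hit i h j ⟧ *ℚ g j) (λ j → ⟦ hit i h j ⟧ *ℚ g′ j))

0≤load : ∀ {n B} (i : Fin n) (h : Hash n B) → 0ℚ ≤ℚ load i h
0≤load i h = 0≤weightedHits i h 0≤f

collides-self : ∀ {n B} (h : Hash n B) i → collides h i i ≡ true
collides-self h i = dec-true (lookup h i FP.≟ lookup h i) refl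

bucketSum≡ : ∀ {n B} (h : Hash n B) i → bucketSum h i ≡ f i + load i h
bucketSum≡ {n} h i = begin-equality
  bucketSum h i
    ≡⟨ bucketSum≡sumOver h i ⟩
  sumOver (allFin n) (λ j → ⟦ collides h i j ⟧ *ℚ f j)
    ≡⟨ sumOver-tabulate id (λ j → ⟦ collides h i j ⟧ *ℚ f j) ⟩
  sum (λ j → ⟦ collides h i j ⟧ *ℚ f j)
    ≡⟨ sum-cong-≗ split ⟩
  sum (λ j → ⟦ does (j FP.≟ i) ⟧ *ℚ f j + ⟦ hit i h j ⟧ *ℚ f j)
    ≡⟨ ∑-distrib-+ (λ j → ⟦ does (j FP.≟ i) ⟧ *ℚ f j) (λ j → ⟦ hit i h j ⟧ *ℚ f j) ⟩
  sum (λ j → ⟦ does (j FP.≟ i) ⟧ *ℚ f j) + load i h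
    ≡⟨ cong (_+ load i h) (sum-select i f) ⟩
  f i + load i h ∎
  where
  split : ∀ j → ⟦ collides h i j ⟧ *ℚ f j ≡ ⟦ does (j FP.≟ i) ⟧ *ℚ f j + ⟦ hit i h j ⟧ *ℚ f j
  split j with j FP.≟ i
  ... | yes refl rewrite collides-self h i = solve 1 (λ x → con 1ℚ :* x := con 1ℚ :* x :+ con 0ℚ :* x) refl (f i)
  ... | no _ = solve 2 (λ c x → c :* x := con 0ℚ :* x :+ c :* x) refl ⟦ collides h i j ⟧ (f j)

-- Hit probabilities and the generating function of the hit count

hashes : ∀ n B → List (Hash n B)
hashes n B = allVecs (allFin B) n

module _ {B} .{{_ : NonZero B}} where

  allFin-nonempty : NonZero (length (allFin B))
  allFin-nonempty = subst NonZero (sym (LP.length-tabulate {n = B} id)) it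
    where
    it : NonZero B
    it = ℕ.≢-nonZero (ℕP.m<n⇒n≢0 (ℕ.>-nonZero⁻¹ B))

  hashes-nonempty : ∀ n → NonZero (length (hashes n B))
  hashes-nonempty = allVecs-nonempty (allFin B) {{allFin-nonempty}}

  𝔼-hash-const : ∀ n c → 𝔼 (hashes n B) (λ _ → c) ≡ c
  𝔼-hash-const n = 𝔼-const (hashes n B) {{hashes-nonempty n}}

  𝔼-bucket : ∀ (b : Fin B) → 𝔼 (allFin B) (λ x → ⟦ does (x FP.≟ b) ⟧) ≡ recip B
  𝔼-bucket b = begin-equality
    𝔼 (allFin B) (λ x → ⟦ does (x FP.≟ b) ⟧)
      ≡⟨ 𝔼≡sumOver (allFin B) _ ⟩
    recip (length (allFin B)) *ℚ sumOver (allFin B) (λ x → ⟦ does (x FP.≟ b) ⟧)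
      ≡⟨ cong₂ _*ℚ_ (cong recip (LP.length-tabulate {n = B} id)) (sumOver-tabulate id (λ x → ⟦ does (x FP.≟ b) ⟧)) ⟩
    recip B *ℚ sum (λ x → ⟦ does (x FP.≟ b) ⟧)
      ≡⟨ cong (recip B *ℚ_) (sum-cong-≗ (λ x → ℚP.*-identityʳ ⟦ does (x FP.≟ b) ⟧)) ⟨
    recip B *ℚ sum (λ x → ⟦ does (x FP.≟ b) ⟧ *ℚ 1ℚ)
      ≡⟨ cong (recip B *ℚ_) (sum-select b (λ _ → 1ℚ)) ⟩
    recip B *ℚ 1ℚ
      ≡⟨ ℚP.*-identityʳ (recip B) ⟩
    recip B ∎

  hit-resampled : ∀ {n} i (h : Hash n B) b j → hit i (h [ i ]≔ b) j ≡ not (does (j FP.≟ i)) ∧ does (lookup h j FP.≟ b)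
  hit-resampled i h b j with j FP.≟ i
  ... | yes _  = refl
  ... | no j≢i = cong₂ (λ x y → does (x FP.≟ y)) (lookup∘update′ j≢i h b) (lookup∘update i h b)

  -- With the bucket of `i` redrawn as `b`, the event is contained in `h(j) = b`, of probability
  -- `1/B`. For `j = i` it is empty, whence the inequality.
  𝔼-hit : ∀ {n} (i j : Fin n) → 𝔼 (hashes n B) (λ h → ⟦ hit i h j ⟧) ≤ℚ recip B
  𝔼-hit {n} i j = begin
    𝔼 (hashes n B) (λ h → ⟦ hit i h j ⟧)
      ≡⟨ 𝔼-resample (allFin B) {{allFin-nonempty}} n i _ ⟩
    𝔼 (allFin B) (λ b → 𝔼 (hashes n B) (λ h → ⟦ hit i (h [ i ]≔ b) j ⟧))
      ≤⟨ 𝔼-mono (allFin B) (λ b → 𝔼-mono (hashes n B) (λ h → drop-≢i h b)) ⟩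
    𝔼 (allFin B) (λ b → 𝔼 (hashes n B) (λ h → ⟦ does (lookup h j FP.≟ b) ⟧))
      ≡⟨ 𝔼-cong (allFin B) (λ b → trans (𝔼-marginal (allFin B) {{allFin-nonempty}} n j (λ x → ⟦ does (x FP.≟ b) ⟧)) (𝔼-bucket b)) ⟩
    𝔼 (allFin B) (λ b → recip B)
      ≡⟨ 𝔼-const (allFin B) {{allFin-nonempty}} (recip B) ⟩
    recip B ∎
    where
    drop-≢i : ∀ h b → ⟦ hit i (h [ i ]≔ b) j ⟧ ≤ℚ ⟦ does (lookup h j FP.≟ b) ⟧
    drop-≢i h b rewrite hit-resampled i h b j with does (j FP.≟ i)
    ... | true  = 0≤⟦⟧ (does (lookup h j FP.≟ b))
    ... | false = ℚP.≤-refl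

  𝔼-weightedHits : ∀ {n} (i : Fin n) {g : Fin n → ℚ} → (∀ j → 0ℚ ≤ℚ g j) →
                   𝔼 (hashes n B) (λ h → weightedHits i h g) ≤ℚ recip B *ℚ sum g
  𝔼-weightedHits {n} i {g} 0≤g = begin
    𝔼 (hashes n B) (λ h → weightedHits i h g)
      ≡⟨ 𝔼-sum (hashes n B) (λ j h → ⟦ hit i h j ⟧ *ℚ g j) ⟩
    sum (λ j → 𝔼 (hashes n B) (λ h → ⟦ hit i h j ⟧ *ℚ g j))
      ≡⟨ sum-cong-≗ (λ j → 𝔼-*ʳ (hashes n B) (g j) (λ h → ⟦ hit i h j ⟧)) ⟩
    sum (λ j → 𝔼 (hashes n B) (λ h → ⟦ hit i h j ⟧) *ℚ g j)
      ≤⟨ sum-mono (λ j → *-monoʳ (0≤g j) (𝔼-hit i j)) ⟩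
    sum (λ j → recip B *ℚ g j)
      ≡⟨ *-distribˡ-sum (recip B) g ⟨
    recip B *ℚ sum g ∎

  -- This is `w^C`, where `C` counts the hits among the `D` smallest indices. For `w = ½` its mean
  -- is the Laplace transform of a Chernoff bound; for `w = 0` it is the indicator of no hit. The
  -- product form is what `𝔼-product` factorises.
  hitWeight : ∀ {n} → ℚ → ℕ → Fin n → Hash n B → ℚ
  hitWeight w D i h = product (λ j → if (toℕ j ℕ.<ᵇ D) ∧ hit i h j then w else 1ℚ)

  𝔼-if : ∀ w (b : Fin B) → 𝔼 (allFin B) (λ x → if does (x FP.≟ b) then w else 1ℚ) ≡ 1ℚ - (1ℚ - w) *ℚ recip B
  𝔼-if w b = begin-equality
    𝔼 (allFin B) (λ x → if does (x FP.≟ b) then w else 1ℚ)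
      ≡⟨ 𝔼-cong (allFin B) (λ x → affine (does (x FP.≟ b))) ⟩
    𝔼 (allFin B) (λ x → 1ℚ + - (1ℚ - w) *ℚ ⟦ does (x FP.≟ b) ⟧)
      ≡⟨ 𝔼-+ (allFin B) (λ _ → 1ℚ) _ ⟩
    𝔼 (allFin B) (λ _ → 1ℚ) + 𝔼 (allFin B) (λ x → - (1ℚ - w) *ℚ ⟦ does (x FP.≟ b) ⟧)
      ≡⟨ cong₂ _+_ (𝔼-const (allFin B) {{allFin-nonempty}} 1ℚ) (trans (𝔼-* (allFin B) (- (1ℚ - w)) _) (cong (- (1ℚ - w) *ℚ_) (𝔼-bucket b))) ⟩
    1ℚ + - (1ℚ - w) *ℚ recip B
      ≡⟨ cong (1ℚ +_) (ℚP.neg-distribˡ-* (1ℚ - w) (recip B)) ⟨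
    1ℚ - (1ℚ - w) *ℚ recip B ∎
    where
    affine : ∀ c → (if c then w else 1ℚ) ≡ 1ℚ + - (1ℚ - w) *ℚ ⟦ c ⟧
    affine true  = solve 1 (λ w → w := con 1ℚ :+ :- (con 1ℚ :- w) :* con 1ℚ) refl w
    affine false = solve 1 (λ w → con 1ℚ := con 1ℚ :+ :- (con 1ℚ :- w) :* con 0ℚ) refl w

  product-1 : ∀ n → product {n} (λ _ → 1ℚ) ≡ 1ℚ
  product-1 zero    = refl
  product-1 (suc n) = trans (ℚP.*-identityˡ (product {n} (λ _ → 1ℚ))) (product-1 n)

  product-below : ∀ {n D} x → D ≤ n → product {n} (λ j → if toℕ j ℕ.<ᵇ D then x else 1ℚ) ≡ x ^ℚ D
  product-below {n}     x z≤n       = product-1 n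
  product-below {suc n} x (s≤s D≤n) = cong (x *ℚ_) (product-below x D≤n)

  product-below-except : ∀ {n D x} (i : Fin n) → D ≤ n → 0ℚ ≤ℚ x → x ≤ℚ 1ℚ →
                         product (λ j → if (toℕ j ℕ.<ᵇ D) ∧ not (does (j FP.≟ i)) then x else 1ℚ) ≤ℚ x ^ℚ (D ℕ.∸ 1)
  product-below-except {n} i z≤n 0≤x x≤1 = ℚP.≤-reflexive (product-1 n)
  product-below-except {suc n} {suc D} {x} zero (s≤s D≤n) 0≤x x≤1 = ℚP.≤-reflexive (trans
    (ℚP.*-identityˡ _)
    (trans (product-cong-≗ {n} (λ j → cong (if_then x else 1ℚ) (∧-identityʳ (toℕ j ℕ.<ᵇ D)))) (product-below x D≤n)))
  -- Here `i` lies beyond the prefix; the surplus factor `x ≤ 1` is given away so that the exponent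
  -- is `D − 1` in all cases.
  product-below-except {suc n} {suc zero} {x} (suc i) (s≤s D≤n) 0≤x x≤1 = begin
    x *ℚ _      ≡⟨ cong (x *ℚ_) (product-1 n) ⟩
    x *ℚ 1ℚ     ≡⟨ ℚP.*-identityʳ x ⟩
    x           ≤⟨ x≤1 ⟩
    1ℚ          ∎
  product-below-except {suc n} {suc (suc D)} (suc i) (s≤s D≤n) 0≤x x≤1 = *-monoˡ 0≤x (product-below-except i D≤n 0≤x x≤1)

  -- The exponent is D ∸ 1 because i itself may be among the D smallest indices.
  𝔼-hitWeight : ∀ {n D w} (i : Fin n) → D ≤ n → 0ℚ ≤ℚ w → w ≤ℚ 1ℚ →
                𝔼 (hashes n B) (hitWeight w D i) ≤ℚ (1ℚ - (1ℚ - w) *ℚ recip B) ^ℚ (D ℕ.∸ 1)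
  𝔼-hitWeight {n} {D} {w} i D≤n 0≤w w≤1 = begin
    𝔼 (hashes n B) (hitWeight w D i)
      ≡⟨ 𝔼-resample (allFin B) {{allFin-nonempty}} n i _ ⟩
    𝔼 (allFin B) (λ b → 𝔼 (hashes n B) (λ h → hitWeight w D i (h [ i ]≔ b)))
      ≤⟨ 𝔼-mono (allFin B) given-bucket ⟩
    𝔼 (allFin B) (λ b → x ^ℚ (D ℕ.∸ 1))
      ≡⟨ 𝔼-const (allFin B) {{allFin-nonempty}} _ ⟩
    x ^ℚ (D ℕ.∸ 1) ∎
    where
    x = 1ℚ - (1ℚ - w) *ℚ recip B
    y = (1ℚ - w) *ℚ recip B
    0≤y : 0ℚ ≤ℚ y
    0≤y = 0≤* (p≤q⇒0≤q-p w≤1) (0≤recip B)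
    x≤1 : x ≤ℚ 1ℚ
    x≤1 = p-q≤p 1ℚ 0≤y
    y≤1 : y ≤ℚ 1ℚ
    y≤1 = *-mono (0≤recip B) 0≤1 (p-q≤p 1ℚ 0≤w) (recip≤1 B)
    factor : Fin B → Fin n → Fin B → ℚ
    factor b j z = if (toℕ j ℕ.<ᵇ D) ∧ (not (does (j FP.≟ i)) ∧ does (z FP.≟ b)) then w else 1ℚ
    𝔼-factor : ∀ b j → 𝔼 (allFin B) (factor b j) ≡ (if (toℕ j ℕ.<ᵇ D) ∧ not (does (j FP.≟ i)) then x else 1ℚ)
    𝔼-factor b j with toℕ j ℕ.<ᵇ D | does (j FP.≟ i)
    ... | true  | true  = 𝔼-const (allFin B) {{allFin-nonempty}} 1ℚ
    ... | true  | false = 𝔼-if w b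
    ... | false | _     = 𝔼-const (allFin B) {{allFin-nonempty}} 1ℚ
    given-bucket : ∀ b → 𝔼 (hashes n B) (λ h → hitWeight w D i (h [ i ]≔ b)) ≤ℚ x ^ℚ (D ℕ.∸ 1)
    given-bucket b = begin
      𝔼 (hashes n B) (λ h → hitWeight w D i (h [ i ]≔ b))
        ≡⟨ 𝔼-cong (hashes n B) (λ h → product-cong-≗ (λ j → cong (λ c → if (toℕ j ℕ.<ᵇ D) ∧ c then w else 1ℚ) (hit-resampled i h b j))) ⟩
      𝔼 (hashes n B) (λ h → product (λ j → factor b j (lookup h j)))
        ≡⟨ 𝔼-product (allFin B) n (factor b) ⟩
      product (λ j → 𝔼 (allFin B) (factor b j))
        ≡⟨ product-cong-≗ (𝔼-factor b) ⟩
      product (λ j → if (toℕ j ℕ.<ᵇ D) ∧ not (does (j FP.≟ i)) then x else 1ℚ)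
        ≤⟨ product-below-except i D≤n (p≤q⇒0≤q-p y≤1) x≤1 ⟩
      x ^ℚ (D ℕ.∸ 1) ∎

-- Dyadic substitutes for the harmonic weights

below : ℕ → ℕ → ℚ
below D j = ⟦ j ℕ.<ᵇ D ⟧

below-yes : ∀ {D j} → j ℕ.< D → below D j ≡ 1ℚ
below-yes {D} {j} j<D with j ℕ.<ᵇ D | ℕP.<⇒<ᵇ j<D
... | true | _ = refl

below-no : ∀ {D j} → D ≤ j → below D j ≡ 0ℚ
below-no {D} {j} D≤j with j ℕ.<ᵇ D in eq
... | false = refl
... | true  = ⊥-elim (ℕP.≤⇒≯ D≤j (ℕP.<ᵇ⇒< j D (subst T (sym eq) _)))

0≤below : ∀ D j → 0ℚ ≤ℚ below D j
0≤below D j = 0≤⟦⟧ (j ℕ.<ᵇ D)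

sum-below : ∀ n D → sum {n} (λ j → below D (toℕ j)) ≤ℚ ι D
sum-below zero    D       = 0≤ι D
sum-below (suc n) zero    = subst (_≤ℚ 0ℚ) (sym (ℚP.+-identityˡ _)) (sum-below n zero)
sum-below (suc n) (suc D) = ℚP.+-monoʳ-≤ 1ℚ (sum-below n D)

-- ∑ of 1/(2ᵘD) over those u < U with j < 2ᵘD, which is of the order of 1/(j+1): it replaces the harmonic weights.
dyadic : ℕ → ℕ → ℕ → ℚ
dyadic zero    D j = 0ℚ
dyadic (suc U) D j = below D j *ℚ recip D + dyadic U (2 * D) j

0≤dyadic : ∀ U D j → 0ℚ ≤ℚ dyadic U D j
0≤dyadic zero    D j = ℚP.≤-refl
0≤dyadic (suc U) D j = 0≤+ (0≤* (0≤below D j) (0≤recip D)) (0≤dyadic U (2 * D) j)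

-- Geometric series: even with all indicators equal to 1, `1/D + 1/(2D) + …` stays below `2/D`.
dyadic≤2/D : ∀ U D j → dyadic U D j ≤ℚ ι 2 *ℚ recip D
dyadic≤2/D zero    D j = 0≤* (0≤ι 2) (0≤recip D)
dyadic≤2/D (suc U) D j = begin
  below D j *ℚ recip D + dyadic U (2 * D) j     ≤⟨ ℚP.+-mono-≤ (⟦⟧*≤ (j ℕ.<ᵇ D) (0≤recip D)) (dyadic≤2/D U (2 * D) j) ⟩
  recip D + ι 2 *ℚ recip (2 * D)                ≡⟨ cong (λ r → recip D + ι 2 *ℚ r) (recip-* 2 D) ⟩
  recip D + ι 2 *ℚ (½ *ℚ recip D)               ≡⟨ solve 1 (λ r → r :+ con (ι 2) :* (con ½ :* r) := con (ι 2) :* r) refl (recip D) ⟩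
  ι 2 *ℚ recip D                                ∎

-- Scales up to `j` contribute nothing, and from the first scale above `j` on the geometric series
-- takes over.
dyadic≤ : ∀ U D j → dyadic U D j ≤ℚ ι 2 *ℚ recip (suc j)
dyadic≤ zero    D j = 0≤* (0≤ι 2) (0≤recip (suc j))
dyadic≤ (suc U) D j with ℕP.<-≤-connex j D
... | inj₁ j<D = ℚP.≤-trans (dyadic≤2/D (suc U) D j) (*-monoˡ (0≤ι 2) (recip-anti j<D))
... | inj₂ D≤j = begin
  below D j *ℚ recip D + dyadic U (2 * D) j     ≡⟨ cong (λ b → b *ℚ recip D + dyadic U (2 * D) j) (below-no D≤j) ⟩
  0ℚ *ℚ recip D + dyadic U (2 * D) j            ≡⟨ solve 2 (λ r d → con 0ℚ :* r :+ d := d) refl (recip D) (dyadic U (2 * D) j) ⟩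
  dyadic U (2 * D) j                            ≤⟨ dyadic≤ U (2 * D) j ⟩
  ι 2 *ℚ recip (suc j)                          ∎

-- The first scale above `j` is at most `2(j+1)`, so its term alone is at least half of `1/(j+1)`.
-- The two hypotheses ensure that this scale is neither skipped by starting too high nor cut off by
-- `U`.
≤dyadic : ∀ U D j .{{_ : NonZero D}} → D ℕ.< 2 * suc j → 2 * suc j ≤ 2 ℕ.^ U * D → recip (suc j) ≤ℚ ι 2 *ℚ dyadic U D j
≤dyadic zero D j D<2j 2j≤D = ⊥-elim (ℕP.<⇒≱ D<2j (subst (2 * suc j ≤_) (ℕP.*-identityˡ D) 2j≤D))
≤dyadic (suc U) D j D<2j 2j≤ with ℕP.<-≤-connex j D
... | inj₁ j<D = begin
  recip (suc j)                                          ≡⟨ ℚP.*-identityˡ (recip (suc j)) ⟨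
  1ℚ *ℚ recip (suc j)                                    ≡⟨ ℚP.*-assoc (ι 2) ½ (recip (suc j)) ⟩
  ι 2 *ℚ (½ *ℚ recip (suc j))                            ≡⟨ cong (ι 2 *ℚ_) (recip-* 2 (suc j)) ⟨
  ι 2 *ℚ recip (2 * suc j)                               ≤⟨ *-monoˡ (0≤ι 2) (recip-anti (ℕP.<⇒≤ D<2j)) ⟩
  ι 2 *ℚ recip D                                         ≡⟨ cong (ι 2 *ℚ_) (ℚP.*-identityˡ (recip D)) ⟨
  ι 2 *ℚ (1ℚ *ℚ recip D)                                 ≡⟨ cong (λ b → ι 2 *ℚ (b *ℚ recip D)) (below-yes j<D) ⟨
  ι 2 *ℚ (below D j *ℚ recip D)                          ≤⟨ *-monoˡ (0≤ι 2) (p≤p+q {below D j *ℚ recip D} (0≤dyadic U (2 * D) j)) ⟩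
  ι 2 *ℚ dyadic (suc U) D j                              ∎
... | inj₂ D≤j = begin
  recip (suc j)                                          ≤⟨ ≤dyadic U (2 * D) j {{ℕP.m*n≢0 2 D}} (ℕP.*-monoʳ-< 2 (s≤s D≤j)) (subst (2 * suc j ≤_) reassoc 2j≤) ⟩
  ι 2 *ℚ dyadic U (2 * D) j                              ≤⟨ *-monoˡ (0≤ι 2) (p≤q+p (0≤* (0≤below D j) (0≤recip D))) ⟩
  ι 2 *ℚ dyadic (suc U) D j                              ∎
  where
  reassoc : 2 ℕ.^ suc U * D ≡ 2 ℕ.^ U * (2 * D)
  reassoc = trans (cong (_* D) (ℕP.*-comm 2 (2 ℕ.^ U))) (ℕP.*-assoc (2 ℕ.^ U) 2 D)

ι*recip≤1 : ∀ n → ι n *ℚ recip n ≤ℚ 1ℚ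
ι*recip≤1 zero      = 0≤1
ι*recip≤1 n@(suc _) = ℚP.≤-reflexive (ι*recip n)

-- A scale has at most `D` indices of weight `1/D`, hence mass at most 1. This is the source of the
-- logarithm in the upper bound.
sum-dyadic : ∀ n U D → sum {n} (λ j → dyadic U D (toℕ j)) ≤ℚ ι U
sum-dyadic n zero    D = ℚP.≤-reflexive (trans (sum-const n 0ℚ) (ℚP.*-zeroʳ (ι n)))
sum-dyadic n (suc U) D = begin
  sum {n} (λ j → dyadic (suc U) D (toℕ j))
    ≡⟨ ∑-distrib-+ {n} (λ j → below D (toℕ j) *ℚ recip D) (λ j → dyadic U (2 * D) (toℕ j)) ⟩
  sum {n} (λ j → below D (toℕ j) *ℚ recip D) + sum {n} (λ j → dyadic U (2 * D) (toℕ j))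
    ≡⟨ cong (_+ sum {n} (λ j → dyadic U (2 * D) (toℕ j))) (*-distribʳ-sum {n} (recip D) (λ j → below D (toℕ j))) ⟨
  sum {n} (λ j → below D (toℕ j)) *ℚ recip D + sum {n} (λ j → dyadic U (2 * D) (toℕ j))
    ≤⟨ ℚP.+-mono-≤ (ℚP.≤-trans (*-monoʳ (0≤recip D) (sum-below n D)) (ι*recip≤1 D)) (sum-dyadic n U (2 * D)) ⟩
  1ℚ + ι U ∎

-- Upper bound

⊓-subadd : ∀ {x x′ y} → 0ℚ ≤ℚ x → 0ℚ ≤ℚ x′ → 0ℚ ≤ℚ y → (x + x′) ⊓ y ≤ℚ x ⊓ y + x′ ⊓ y
⊓-subadd {x} {x′} {y} 0≤x 0≤x′ 0≤y with ℚP.≤-total x y | ℚP.≤-total x′ y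
... | inj₁ x≤y | inj₁ x′≤y = subst ((x + x′) ⊓ y ≤ℚ_) (sym (cong₂ _+_ (ℚP.p≤q⇒p⊓q≡p x≤y) (ℚP.p≤q⇒p⊓q≡p x′≤y))) (ℚP.p⊓q≤p (x + x′) y)
... | inj₂ y≤x | _ = begin
  (x + x′) ⊓ y         ≤⟨ ℚP.p⊓q≤q (x + x′) y ⟩
  y                    ≡⟨ ℚP.p≥q⇒p⊓q≡q y≤x ⟨
  x ⊓ y                ≤⟨ p≤p+q (ℚP.⊓-glb 0≤x′ 0≤y) ⟩
  x ⊓ y + x′ ⊓ y       ∎
... | inj₁ _ | inj₂ y≤x′ = begin
  (x + x′) ⊓ y         ≤⟨ ℚP.p⊓q≤q (x + x′) y ⟩
  y                    ≡⟨ ℚP.p≥q⇒p⊓q≡q y≤x′ ⟨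
  x′ ⊓ y               ≤⟨ p≤q+p (ℚP.⊓-glb 0≤x 0≤y) ⟩
  x ⊓ y + x′ ⊓ y       ∎

sum-⊓ : ∀ {n} {φ : Fin n → ℚ} {y} → (∀ j → 0ℚ ≤ℚ φ j) → 0ℚ ≤ℚ y → sum φ ⊓ y ≤ℚ sum (λ j → φ j ⊓ y)
sum-⊓ {zero}          {y = y} 0≤φ 0≤y = ℚP.p⊓q≤p 0ℚ y
sum-⊓ {suc n} {φ = φ} {y = y} 0≤φ 0≤y = ℚP.≤-trans (⊓-subadd (0≤φ zero) (0≤sum (0≤φ ∘ suc)) 0≤y)
  (ℚP.+-monoʳ-≤ (φ zero ⊓ y) (sum-⊓ (0≤φ ∘ suc) 0≤y))

sum-⊓-sum : ∀ {m n} {φ : Fin m → ℚ} {ψ : Fin n → ℚ} → (∀ j → 0ℚ ≤ℚ φ j) → (∀ l → 0ℚ ≤ℚ ψ l) →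
            sum φ ⊓ sum ψ ≤ℚ sum (λ j → sum (λ l → φ j ⊓ ψ l))
sum-⊓-sum {φ = φ} {ψ} 0≤φ 0≤ψ = ℚP.≤-trans (sum-⊓ 0≤φ (0≤sum 0≤ψ)) (sum-mono inner)
  where
  inner : ∀ j → φ j ⊓ sum ψ ≤ℚ sum (λ l → φ j ⊓ ψ l)
  inner j = begin
    φ j ⊓ sum ψ                ≡⟨ ℚP.⊓-comm (φ j) (sum ψ) ⟩
    sum ψ ⊓ φ j                ≤⟨ sum-⊓ 0≤ψ (0≤φ j) ⟩
    sum (λ l → ψ l ⊓ φ j)      ≡⟨ sum-cong-≗ (λ l → ℚP.⊓-comm (ψ l) (φ j)) ⟩
    sum (λ l → φ j ⊓ ψ l)      ∎

-- Lets the light parts leave the minimum additively: their means are already of the right order,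
-- and only the heavy parts need both rows.
⊓-split : ∀ {a b c d} → 0ℚ ≤ℚ b → 0ℚ ≤ℚ d → (a + b) ⊓ (c + d) ≤ℚ a ⊓ c + (b + d)
⊓-split {a} {b} {c} {d} 0≤b 0≤d with ℚP.≤-total a c
... | inj₁ a≤c = begin
  (a + b) ⊓ (c + d)      ≤⟨ ℚP.p⊓q≤p (a + b) (c + d) ⟩
  a + b                  ≤⟨ ℚP.+-monoʳ-≤ a (p≤p+q 0≤d) ⟩
  a + (b + d)            ≡⟨ cong (_+ (b + d)) (ℚP.p≤q⇒p⊓q≡p a≤c) ⟨
  a ⊓ c + (b + d)        ∎
... | inj₂ c≤a = begin
  (a + b) ⊓ (c + d)      ≤⟨ ℚP.p⊓q≤q (a + b) (c + d) ⟩
  c + d                  ≤⟨ ℚP.+-monoʳ-≤ c (p≤q+p 0≤b) ⟩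
  c + (b + d)            ≡⟨ cong (_+ (b + d)) (ℚP.p≥q⇒p⊓q≡q c≤a) ⟨
  a ⊓ c + (b + d)        ∎

-- A vanishing entry forces the minimum to 0, so it is governed by the product of the indicators,
-- whose mean factorises over the two rows.
⟦⟧*⊓⟦⟧* : ∀ b c {x y} → 0ℚ ≤ℚ x → 0ℚ ≤ℚ y → (⟦ b ⟧ *ℚ x) ⊓ (⟦ c ⟧ *ℚ y) ≤ℚ ⟦ b ⟧ *ℚ (⟦ c ⟧ *ℚ (x ⊓ y))
⟦⟧*⊓⟦⟧* true true {x} {y} 0≤x 0≤y = ℚP.≤-reflexive (trans (cong₂ _⊓_ (ℚP.*-identityˡ x) (ℚP.*-identityˡ y))
  (sym (trans (ℚP.*-identityˡ _) (ℚP.*-identityˡ (x ⊓ y)))))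
⟦⟧*⊓⟦⟧* true false {x} {y} 0≤x 0≤y = ℚP.≤-trans (ℚP.p⊓q≤q (1ℚ *ℚ x) (0ℚ *ℚ y))
  (ℚP.≤-reflexive (solve 2 (λ y m → con 0ℚ :* y := con 1ℚ :* (con 0ℚ :* m)) refl y (x ⊓ y)))
⟦⟧*⊓⟦⟧* false c {x} {y} 0≤x 0≤y = ℚP.≤-trans (ℚP.p⊓q≤p (0ℚ *ℚ x) (⟦ c ⟧ *ℚ y))
  (ℚP.≤-reflexive (solve 2 (λ x m → con 0ℚ :* x := con 0ℚ :* m) refl x (⟦ c ⟧ *ℚ (x ⊓ y))))

-- Indices count from 0, so `heavy B` keeps exactly the items numbered 1 to `B`. At this threshold
-- the light weights sum to order `log (n/B)`, while the pairwise minima of heavy ones sum to order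
-- `B`.
heavy light : ∀ {n} → ℕ → Fin n → ℚ
heavy B j = below B (toℕ j) *ℚ f j
light B j = (1ℚ - below B (toℕ j)) *ℚ f j

0≤heavy : ∀ {n} B (j : Fin n) → 0ℚ ≤ℚ heavy B j
0≤heavy B j = 0≤* (0≤below B (toℕ j)) (0≤f j)

below≤1 : ∀ D j → below D j ≤ℚ 1ℚ
below≤1 D j with j ℕ.<ᵇ D
... | true  = ℚP.≤-refl
... | false = 0≤1

0≤light : ∀ {n} B (j : Fin n) → 0ℚ ≤ℚ light B j
0≤light B j = 0≤* (p≤q⇒0≤q-p (below≤1 B (toℕ j))) (0≤f j)

-- Each pair is charged to its larger index, whose weight bounds the minimum. An index `j < B` is
-- charged for at most `j+1` partners at weight `1/(j+1)`, so with mass at most 1; the two orders of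
-- a pair give the two summands.
sum-heavy-⊓ : ∀ n B → sum {n} (λ j → sum {n} (λ l → heavy B j ⊓ heavy B l)) ≤ℚ ι B + ι B
sum-heavy-⊓ n B = begin
  sum {n} (λ j → sum {n} (λ l → heavy B j ⊓ heavy B l))
    ≤⟨ sum-mono (λ j → sum-mono (λ l → charge j l)) ⟩
  sum {n} (λ j → sum {n} (λ l → row j l + row l j))
    ≡⟨ sum-cong-≗ (λ j → ∑-distrib-+ (row j) (λ l → row l j)) ⟩
  sum {n} (λ j → sum (row j) + sum (λ l → row l j))
    ≡⟨ ∑-distrib-+ (λ j → sum (row j)) (λ j → sum (λ l → row l j)) ⟩
  sum {n} (λ j → sum (row j)) + sum {n} (λ j → sum (λ l → row l j))
    ≡⟨ cong (sum {n} (λ j → sum (row j)) +_) (∑-comm row) ⟨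
  sum {n} (λ j → sum (row j)) + sum {n} (λ j → sum (row j))
    ≤⟨ ℚP.+-mono-≤ rows rows ⟩
  ι B + ι B ∎
  where
  row : Fin n → Fin n → ℚ
  row j l = heavy B j *ℚ below (suc (toℕ j)) (toℕ l)
  0≤row : ∀ j l → 0ℚ ≤ℚ row j l
  0≤row j l = 0≤* (0≤heavy B j) (0≤below (suc (toℕ j)) (toℕ l))
  row≡ : ∀ {j l} → toℕ l ≤ toℕ j → heavy B j ≡ row j l
  row≡ {j} l≤j = sym (trans (cong (heavy B j *ℚ_) (below-yes (s≤s l≤j))) (ℚP.*-identityʳ (heavy B j)))
  charge : ∀ j l → heavy B j ⊓ heavy B l ≤ℚ row j l + row l j
  charge j l with ℕP.≤-total (toℕ l) (toℕ j)
  ... | inj₁ l≤j = begin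
    heavy B j ⊓ heavy B l     ≤⟨ ℚP.p⊓q≤p (heavy B j) (heavy B l) ⟩
    heavy B j                 ≡⟨ row≡ l≤j ⟩
    row j l                   ≤⟨ p≤p+q (0≤row l j) ⟩
    row j l + row l j         ∎
  ... | inj₂ j≤l = begin
    heavy B j ⊓ heavy B l     ≤⟨ ℚP.p⊓q≤q (heavy B j) (heavy B l) ⟩
    heavy B l                 ≡⟨ row≡ j≤l ⟩
    row l j                   ≤⟨ p≤q+p (0≤row j l) ⟩
    row j l + row l j         ∎
  sum-row : ∀ j → sum (row j) ≤ℚ below B (toℕ j)
  sum-row j = begin
    sum (row j)
      ≡⟨ *-distribˡ-sum {n} (heavy B j) (λ l → below (suc (toℕ j)) (toℕ l)) ⟨
    heavy B j *ℚ sum {n} (λ l → below (suc (toℕ j)) (toℕ l))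
      ≤⟨ *-monoˡ (0≤heavy B j) (sum-below n (suc (toℕ j))) ⟩
    below B (toℕ j) *ℚ f j *ℚ ι (suc (toℕ j))
      ≡⟨ solve 3 (λ b r k → b :* r :* k := b :* (k :* r)) refl (below B (toℕ j)) (f j) (ι (suc (toℕ j))) ⟩
    below B (toℕ j) *ℚ (ι (suc (toℕ j)) *ℚ f j)
      ≡⟨ cong (below B (toℕ j) *ℚ_) (ι*recip (suc (toℕ j))) ⟩
    below B (toℕ j) *ℚ 1ℚ
      ≡⟨ ℚP.*-identityʳ _ ⟩
    below B (toℕ j) ∎
  rows : sum {n} (λ j → sum (row j)) ≤ℚ ι B
  rows = ℚP.≤-trans (sum-mono sum-row) (sum-below n B)

sum-light : ∀ n B U .{{_ : NonZero B}} → n ≤ 2 ℕ.^ U * B → sum {n} (light B) ≤ℚ ι 2 *ℚ ι U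
sum-light n B U n≤ = begin
  sum {n} (light B)
    ≤⟨ sum-mono bound ⟩
  sum {n} (λ j → ι 2 *ℚ dyadic U (2 * B) (toℕ j))
    ≡⟨ *-distribˡ-sum (ι 2) (λ (j : Fin n) → dyadic U (2 * B) (toℕ j)) ⟨
  ι 2 *ℚ sum {n} (λ j → dyadic U (2 * B) (toℕ j))
    ≤⟨ *-monoˡ (0≤ι 2) (sum-dyadic n U (2 * B)) ⟩
  ι 2 *ℚ ι U ∎
  where
  swap-2 : 2 * (2 ℕ.^ U * B) ≡ 2 ℕ.^ U * (2 * B)
  swap-2 = trans (sym (ℕP.*-assoc 2 (2 ℕ.^ U) B)) (trans (cong (_* B) (ℕP.*-comm 2 (2 ℕ.^ U))) (ℕP.*-assoc (2 ℕ.^ U) 2 B))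
  -- Starting the scales at `2B` turns the first condition of `≤dyadic` into `B ≤ j`; the second is
  -- twice `j+1 ≤ n ≤ 2^U B`.
  bound : ∀ j → light B j ≤ℚ ι 2 *ℚ dyadic U (2 * B) (toℕ j)
  bound j with ℕP.<-≤-connex (toℕ j) B
  ... | inj₁ j<B = begin
    (1ℚ - below B (toℕ j)) *ℚ f j       ≡⟨ cong (λ b → (1ℚ - b) *ℚ f j) (below-yes j<B) ⟩
    0ℚ *ℚ f j                           ≡⟨ ℚP.*-zeroˡ (f j) ⟩
    0ℚ                                  ≤⟨ 0≤* (0≤ι 2) (0≤dyadic U (2 * B) (toℕ j)) ⟩
    ι 2 *ℚ dyadic U (2 * B) (toℕ j)     ∎
  ... | inj₂ B≤j = begin
    (1ℚ - below B (toℕ j)) *ℚ f j       ≡⟨ cong (λ b → (1ℚ - b) *ℚ f j) (below-no B≤j) ⟩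
    1ℚ *ℚ f j                           ≡⟨ ℚP.*-identityˡ (f j) ⟩
    f j                                 ≤⟨ ≤dyadic U (2 * B) (toℕ j) {{ℕP.m*n≢0 2 B}} (ℕP.*-monoʳ-< 2 (s≤s B≤j))
                                             (subst (2 * suc (toℕ j) ≤_) swap-2 (ℕP.*-monoʳ-≤ 2 (ℕP.≤-trans (FP.toℕ<n j) n≤))) ⟩
    ι 2 *ℚ dyadic U (2 * B) (toℕ j)     ∎

module _ {n B} .{{_ : NonZero B}} (i : Fin n) where

  private
    H = hashes n B
    p = recip B

  0≤p : 0ℚ ≤ℚ p
  0≤p = 0≤recip B

  load-split : ∀ (h : Hash n B) → load i h ≡ weightedHits i h (heavy B) + weightedHits i h (light B)
  load-split h = trans (sum-cong-≗ (λ j → cong (⟦ hit i h j ⟧ *ℚ_) (split (below B (toℕ j)) (f j))))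
    (weightedHits-+ i h (heavy B) (light B))
    where
    split : ∀ b x → x ≡ b *ℚ x + (1ℚ - b) *ℚ x
    split = solve 2 (λ b x → x := b :* x :+ (con 1ℚ :- b) :* x) refl

  load-⊓-load : ∀ (h₁ h₂ : Hash n B) → load i h₁ ⊓ load i h₂ ≤ℚ
                weightedHits i h₁ (λ j → weightedHits i h₂ (λ l → heavy B j ⊓ heavy B l))
                + (weightedHits i h₁ (light B) + weightedHits i h₂ (light B))
  load-⊓-load h₁ h₂ = begin
    load i h₁ ⊓ load i h₂
      ≡⟨ cong₂ _⊓_ (load-split h₁) (load-split h₂) ⟩
    (weightedHits i h₁ (heavy B) + weightedHits i h₁ (light B)) ⊓ (weightedHits i h₂ (heavy B) + weightedHits i h₂ (light B))
      ≤⟨ ⊓-split {weightedHits i h₁ (heavy B)} {_} {weightedHits i h₂ (heavy B)} (0≤weightedHits i h₁ (0≤light B)) (0≤weightedHits i h₂ (0≤light B)) ⟩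
    weightedHits i h₁ (heavy B) ⊓ weightedHits i h₂ (heavy B) + (weightedHits i h₁ (light B) + weightedHits i h₂ (light B))
      ≤⟨ ℚP.+-monoˡ-≤ (weightedHits i h₁ (light B) + weightedHits i h₂ (light B)) heavy-⊓ ⟩
    weightedHits i h₁ (λ j → weightedHits i h₂ (λ l → heavy B j ⊓ heavy B l))
    + (weightedHits i h₁ (light B) + weightedHits i h₂ (light B)) ∎
    where
    heavy-⊓ : weightedHits i h₁ (heavy B) ⊓ weightedHits i h₂ (heavy B) ≤ℚ
              weightedHits i h₁ (λ j → weightedHits i h₂ (λ l → heavy B j ⊓ heavy B l))
    heavy-⊓ = begin
      weightedHits i h₁ (heavy B) ⊓ weightedHits i h₂ (heavy B)
        ≤⟨ sum-⊓-sum (λ j → 0≤* (0≤⟦⟧ (hit i h₁ j)) (0≤heavy B j)) (λ l → 0≤* (0≤⟦⟧ (hit i h₂ l)) (0≤heavy B l)) ⟩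
      sum {n} (λ j → sum {n} (λ l → (⟦ hit i h₁ j ⟧ *ℚ heavy B j) ⊓ (⟦ hit i h₂ l ⟧ *ℚ heavy B l)))
        ≤⟨ sum-mono (λ j → sum-mono (λ l → ⟦⟧*⊓⟦⟧* (hit i h₁ j) (hit i h₂ l) (0≤heavy B j) (0≤heavy B l))) ⟩
      sum {n} (λ j → sum {n} (λ l → ⟦ hit i h₁ j ⟧ *ℚ (⟦ hit i h₂ l ⟧ *ℚ (heavy B j ⊓ heavy B l))))
        ≡⟨ sum-cong-≗ (λ j → *-distribˡ-sum ⟦ hit i h₁ j ⟧ (λ l → ⟦ hit i h₂ l ⟧ *ℚ (heavy B j ⊓ heavy B l))) ⟨
      weightedHits i h₁ (λ j → weightedHits i h₂ (λ l → heavy B j ⊓ heavy B l)) ∎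

  𝔼-load-⊓-load : 𝔼 H (λ h₁ → 𝔼 H (λ h₂ → load i h₁ ⊓ load i h₂)) ≤ℚ ι 2 *ℚ p + ι 2 *ℚ (p *ℚ sum {n} (light B))
  𝔼-load-⊓-load = begin
    𝔼 H (λ h₁ → 𝔼 H (λ h₂ → load i h₁ ⊓ load i h₂))
      ≤⟨ 𝔼-mono H (λ h₁ → 𝔼-mono H (load-⊓-load h₁)) ⟩
    𝔼 H (λ h₁ → 𝔼 H (λ h₂ → pairs h₁ h₂ + (lights h₁ + lights h₂)))
      ≡⟨ 𝔼-cong H (λ h₁ → trans (𝔼-+ H (pairs h₁) _) (cong (𝔼 H (pairs h₁) +_) (trans (𝔼-+ H (λ _ → lights h₁) lights)
           (cong (_+ 𝔼 H lights) (𝔼-hash-const n (lights h₁)))))) ⟩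
    𝔼 H (λ h₁ → 𝔼 H (pairs h₁) + (lights h₁ + 𝔼 H lights))
      ≡⟨ trans (𝔼-+ H (λ h₁ → 𝔼 H (pairs h₁)) _) (cong (𝔼 H (λ h₁ → 𝔼 H (pairs h₁)) +_) (trans (𝔼-+ H lights (λ _ → 𝔼 H lights))
           (cong (𝔼 H lights +_) (𝔼-hash-const n (𝔼 H lights))))) ⟩
    𝔼 H (λ h₁ → 𝔼 H (pairs h₁)) + (𝔼 H lights + 𝔼 H lights)
      ≤⟨ ℚP.+-mono-≤ 𝔼-pairs (ℚP.+-mono-≤ (𝔼-weightedHits i (0≤light B)) (𝔼-weightedHits i (0≤light B))) ⟩
    ι 2 *ℚ p + (p *ℚ sum {n} (light B) + p *ℚ sum {n} (light B))
      ≡⟨ cong (ι 2 *ℚ p +_) (solve 1 (λ x → x :+ x := con (ι 2) :* x) refl (p *ℚ sum {n} (light B))) ⟩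
    ι 2 *ℚ p + ι 2 *ℚ (p *ℚ sum {n} (light B)) ∎
    where
    lights : Hash n B → ℚ
    lights h = weightedHits i h (light B)
    pairs : Hash n B → Hash n B → ℚ
    pairs h₁ h₂ = weightedHits i h₁ (λ j → weightedHits i h₂ (λ l → heavy B j ⊓ heavy B l))
    0≤⊓ : ∀ (j l : Fin n) → 0ℚ ≤ℚ heavy B j ⊓ heavy B l
    0≤⊓ j l = ℚP.⊓-glb (0≤heavy B j) (0≤heavy B l)
    -- `h₁` is averaged first, with the weights coming from `h₂` frozen, and then `h₂`. Each average
    -- yields a factor `1/B`, and `B⁻² · 2B` is `2/B`.
    𝔼-pairs : 𝔼 H (λ h₁ → 𝔼 H (pairs h₁)) ≤ℚ ι 2 *ℚ p
    𝔼-pairs = begin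
      𝔼 H (λ h₁ → 𝔼 H (pairs h₁))
        ≡⟨ 𝔼-swap H H pairs ⟩
      𝔼 H (λ h₂ → 𝔼 H (λ h₁ → pairs h₁ h₂))
        ≤⟨ 𝔼-mono H (λ h₂ → 𝔼-weightedHits i (λ j → 0≤weightedHits i h₂ (0≤⊓ j))) ⟩
      𝔼 H (λ h₂ → p *ℚ sum {n} (λ j → weightedHits i h₂ (λ l → heavy B j ⊓ heavy B l)))
        ≡⟨ trans (𝔼-* H p _) (cong (p *ℚ_) (𝔼-sum H {n} (λ j h₂ → weightedHits i h₂ (λ l → heavy B j ⊓ heavy B l)))) ⟩
      p *ℚ sum {n} (λ j → 𝔼 H (λ h₂ → weightedHits i h₂ (λ l → heavy B j ⊓ heavy B l)))
        ≤⟨ *-monoˡ 0≤p (sum-mono (λ j → 𝔼-weightedHits i (0≤⊓ j))) ⟩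
      p *ℚ sum {n} (λ j → p *ℚ sum {n} (λ l → heavy B j ⊓ heavy B l))
        ≡⟨ cong (p *ℚ_) (*-distribˡ-sum p (λ (j : Fin n) → sum {n} (λ l → heavy B j ⊓ heavy B l))) ⟨
      p *ℚ (p *ℚ sum {n} (λ j → sum {n} (λ l → heavy B j ⊓ heavy B l)))
        ≤⟨ *-monoˡ 0≤p (*-monoˡ 0≤p (sum-heavy-⊓ n B)) ⟩
      p *ℚ (p *ℚ (ι B + ι B))
        ≡⟨ solve 2 (λ p b → p :* (p :* (b :+ b)) := con (ι 2) :* p :* (b :* p)) refl p (ι B) ⟩
      ι 2 *ℚ p *ℚ (ι B *ℚ p)
        ≡⟨ cong (ι 2 *ℚ p *ℚ_) (ι*recip B) ⟩
      ι 2 *ℚ p *ℚ 1ℚ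
        ≡⟨ ℚP.*-identityʳ _ ⟩
      ι 2 *ℚ p ∎

-- The error of the sketch in terms of the row errors

private
  error : ∀ {n B k} → Fin n → Vec (Hash n B) k → ℚ
  error i hs = ∣ ftilde hs i - f i ∣

f≤ftilde : ∀ {n B k} (i : Fin n) (hs : Vec (Hash n B) (suc k)) → f i ≤ℚ ftilde hs i
f≤ftilde i (h ∷ [])      = subst (f i ≤ℚ_) (sym (bucketSum≡ h i)) (p≤p+q (0≤load i h))
f≤ftilde i (h ∷ g ∷ hs) = ℚP.⊓-glb (subst (f i ≤ℚ_) (sym (bucketSum≡ h i)) (p≤p+q (0≤load i h))) (f≤ftilde i (g ∷ hs))

ftilde-head : ∀ {n B k} (i : Fin n) (h : Hash n B) (hs : Vec (Hash n B) k) → ftilde (h ∷ hs) i - f i ≤ℚ load i h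
ftilde-head i h hs = ≤+⇒-≤ {_} {_} {f i} (ℚP.≤-trans (head≤ hs) (ℚP.≤-reflexive (trans (bucketSum≡ h i) (ℚP.+-comm (f i) (load i h)))))
  where
  head≤ : ∀ {k} (hs : Vec _ k) → ftilde (h ∷ hs) i ≤ℚ bucketSum h i
  head≤ []       = ℚP.≤-refl
  head≤ (g ∷ hs) = ℚP.p⊓q≤p (bucketSum h i) (ftilde (g ∷ hs) i)

-- Further rows only lower the minimum, so two of them carry an upper bound uniform in `k`.
error≤load-⊓-load : ∀ {n B k} (i : Fin n) (h₁ h₂ : Hash n B) (hs : Vec (Hash n B) k) →
                    error i (h₁ ∷ h₂ ∷ hs) ≤ℚ load i h₁ ⊓ load i h₂
error≤load-⊓-load i h₁ h₂ hs = begin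
  error i (h₁ ∷ h₂ ∷ hs)               ≡⟨ ℚP.0≤p⇒∣p∣≡p (p≤q⇒0≤q-p (f≤ftilde i (h₁ ∷ h₂ ∷ hs))) ⟩
  ftilde (h₁ ∷ h₂ ∷ hs) i - f i        ≤⟨ ℚP.⊓-glb (ftilde-head i h₁ (h₂ ∷ hs)) second ⟩
  load i h₁ ⊓ load i h₂                ∎
  where
  second : ftilde (h₁ ∷ h₂ ∷ hs) i - f i ≤ℚ load i h₂
  second = ℚP.≤-trans (ℚP.+-monoˡ-≤ (- f i) (ℚP.p⊓q≤q (bucketSum h₁ i) (ftilde (h₂ ∷ hs) i))) (ftilde-head i h₂ hs)

p≤∣p∣ : ∀ p → p ≤ℚ ∣ p ∣
p≤∣p∣ p with ℚP.≤-total 0ℚ p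
... | inj₁ 0≤p = ℚP.≤-reflexive (sym (ℚP.0≤p⇒∣p∣≡p 0≤p))
... | inj₂ p≤0 = ℚP.≤-trans p≤0 (ℚP.0≤∣p∣ p)

module _ {n B} .{{_ : NonZero B}} (i : Fin n) where

  private
    H = hashes n B

  expectedError≤ : ∀ {k} → 2 ≤ k → expectedError n B k i ≤ℚ 𝔼 H (λ h₁ → 𝔼 H (λ h₂ → load i h₁ ⊓ load i h₂))
  expectedError≤ {suc (suc k)} (s≤s (s≤s _)) = begin
    𝔼 (allVecs H (suc (suc k))) (error i)
      ≡⟨ trans (𝔼-∷ H (suc k) (error i)) (𝔼-cong H (λ h₁ → 𝔼-∷ H k (λ hs → error i (h₁ ∷ hs)))) ⟩
    𝔼 H (λ h₁ → 𝔼 H (λ h₂ → 𝔼 (allVecs H k) (λ hs → error i (h₁ ∷ h₂ ∷ hs))))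
      ≤⟨ 𝔼-mono H (λ h₁ → 𝔼-mono H (λ h₂ → 𝔼-mono (allVecs H k) (error≤load-⊓-load i h₁ h₂))) ⟩
    𝔼 H (λ h₁ → 𝔼 H (λ h₂ → 𝔼 (allVecs H k) (λ hs → load i h₁ ⊓ load i h₂)))
      ≡⟨ 𝔼-cong H (λ h₁ → 𝔼-cong H (λ h₂ → 𝔼-const (allVecs H k) {{allVecs-nonempty H {{hashes-nonempty n}} k}} (load i h₁ ⊓ load i h₂))) ⟩
    𝔼 H (λ h₁ → 𝔼 H (λ h₂ → load i h₁ ⊓ load i h₂)) ∎

  module _ {a : ℚ} {Z : Hash n B → ℚ} (0≤Z : ∀ h → 0ℚ ≤ℚ Z h) (a≤load+Z : ∀ h → a ≤ℚ load i h + Z h) where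

    -- The minimum is attained at some row, whose own bound suffices; the defects `Z` of the other
    -- rows are nonnegative and may be added.
    a≤error+∑Z : ∀ {k} (hs : Vec (Hash n B) (suc k)) → a ≤ℚ error i hs + sum (λ l → Z (lookup hs l))
    a≤error+∑Z hs = ℚP.≤-trans (above hs) (ℚP.+-monoˡ-≤ (sum (λ l → Z (lookup hs l))) (p≤∣p∣ (ftilde hs i - f i)))
      where
      row : ∀ h → a ≤ℚ bucketSum h i - f i + Z h
      row h = subst (λ b → a ≤ℚ b + Z h)
        (sym (trans (cong (_- f i) (bucketSum≡ h i)) (solve 2 (λ x y → x :+ y :- x := y) refl (f i) (load i h)))) (a≤load+Z h)
      above : ∀ {k} (hs : Vec (Hash n B) (suc k)) → a ≤ℚ ftilde hs i - f i + sum (λ l → Z (lookup hs l))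
      above (h ∷ [])         = subst (λ z → a ≤ℚ bucketSum h i - f i + z) (sym (ℚP.+-identityʳ (Z h))) (row h)
      above (h ∷ hs@(g ∷ _)) with ℚP.≤-total (bucketSum h i) (ftilde hs i)
      ... | inj₁ h≤hs = begin
        a                                                ≤⟨ row h ⟩
        bucketSum h i - f i + Z h                        ≡⟨ cong (λ b → b - f i + Z h) (ℚP.p≤q⇒p⊓q≡p h≤hs) ⟨
        ftilde (h ∷ hs) i - f i + Z h                    ≤⟨ ℚP.+-monoʳ-≤ (ftilde (h ∷ hs) i - f i) (p≤p+q (0≤sum (λ l → 0≤Z (lookup hs l)))) ⟩
        ftilde (h ∷ hs) i - f i + (Z h + sum (λ l → Z (lookup hs l))) ∎
      ... | inj₂ hs≤h = begin
        a                                                ≤⟨ above hs ⟩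
        ftilde hs i - f i + sum (λ l → Z (lookup hs l))  ≡⟨ cong (λ b → b - f i + sum (λ l → Z (lookup hs l))) (ℚP.p≥q⇒p⊓q≡q hs≤h) ⟨
        ftilde (h ∷ hs) i - f i + sum (λ l → Z (lookup hs l)) ≤⟨ ℚP.+-monoʳ-≤ (ftilde (h ∷ hs) i - f i) (p≤q+p (0≤Z h)) ⟩
        ftilde (h ∷ hs) i - f i + (Z h + sum (λ l → Z (lookup hs l))) ∎

    -- A union bound over the rows: only the marginal law of a single hash function enters.
    ≤expectedError : ∀ {k} → 1 ≤ k → a ≤ℚ expectedError n B k i + ι k *ℚ 𝔼 H Z
    ≤expectedError {suc k} _ = begin
      a
        ≡⟨ 𝔼-const K {{nonempty}} a ⟨
      𝔼 K (λ _ → a)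
        ≤⟨ 𝔼-mono K a≤error+∑Z ⟩
      𝔼 K (λ hs → error i hs + sum (λ l → Z (lookup hs l)))
        ≡⟨ 𝔼-+ K (error i) (λ hs → sum (λ l → Z (lookup hs l))) ⟩
      𝔼 K (error i) + 𝔼 K (λ hs → sum (λ l → Z (lookup hs l)))
        ≡⟨ cong (𝔼 K (error i) +_) (trans (𝔼-sum K (λ l hs → Z (lookup hs l)))
             (sum-cong-≗ (λ l → 𝔼-marginal H {{hashes-nonempty n}} (suc k) l Z))) ⟩
      𝔼 K (error i) + sum {suc k} (λ _ → 𝔼 H Z)
        ≡⟨ cong (𝔼 K (error i) +_) (sum-const (suc k) (𝔼 H Z)) ⟩
      𝔼 K (error i) + ι (suc k) *ℚ 𝔼 H Z ∎
      where
      K = allVecs H (suc k)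
      nonempty : NonZero (length K)
      nonempty = allVecs-nonempty H {{hashes-nonempty n}} (suc k)

-- ⌊log₂⌋ and powers of two

n<2^n : ∀ n → n ℕ.< 2 ℕ.^ n
n<2^n zero    = s≤s z≤n
n<2^n (suc n) = ℕP.≤-trans (ℕP.+-mono-≤ (ℕP.m^n>0 2 n) (n<2^n n)) (ℕP.≤-reflexive (cong (2 ℕ.^ n ℕ.+_) (sym (ℕP.+-identityʳ (2 ℕ.^ n)))))

n<2^1+⌊log₂n⌋ : ∀ n → n ℕ.< 2 ℕ.^ suc ⌊log₂ n ⌋
n<2^1+⌊log₂n⌋ n = ℕP.≰⇒> (λ le → ℕP.1+n≰n (subst (_≤ ⌊log₂ n ⌋) (⌊log₂[2^n]⌋≡n (suc ⌊log₂ n ⌋)) (⌊log₂⌋-mono-≤ le)))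

2^⌊log₂n⌋≤n : ∀ n → 1 ≤ n → 2 ℕ.^ ⌊log₂ n ⌋ ≤ n
2^⌊log₂n⌋≤n n 1≤n = go ⌊log₂ n ⌋ n refl 1≤n
  where
  go : ∀ L n → ⌊log₂ n ⌋ ≡ L → 1 ≤ n → 2 ℕ.^ L ≤ n
  go zero    n                 eq 1≤n = 1≤n
  go (suc L) (suc zero)        () 1≤n
  go (suc L) n@(suc (suc m))   eq 1≤n = ℕP.≤-trans (ℕP.*-monoʳ-≤ 2 (go L ℕ.⌊ n /2⌋ (trans (⌊log₂⌊n/2⌋⌋≡⌊log₂n⌋∸1 n) (cong (ℕ._∸ 1) eq)) (s≤s z≤n)))
    (ℕP.≤-trans (ℕP.+-monoʳ-≤ ℕ.⌊ n /2⌋ (ℕP.≤-trans (ℕP.≤-reflexive (ℕP.+-identityʳ ℕ.⌊ n /2⌋)) (ℕP.⌊n/2⌋≤⌈n/2⌉ n)))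
      (ℕP.≤-reflexive (ℕP.⌊n/2⌋+⌈n/2⌉≡n n)))

module _ {n B k : ℕ} .{{_ : NonZero B}} (kB≤n : k * B ≤ n) where

  k≤n/B : k ≤ n ℕ./ B
  k≤n/B = subst (_≤ n ℕ./ B) (m*n/n≡m k B) (/-monoˡ-≤ B kB≤n)

  private
    L = ⌊log₂ n ℕ./ B ⌋

  -- Caps the loss in the union bound: a tail of order `2^(−r)` absorbs the factor `k` once `r`
  -- exceeds `L` by a constant.
  k≤2^1+L : k ≤ 2 ℕ.^ suc L
  k≤2^1+L = ℕP.≤-trans k≤n/B (ℕP.<⇒≤ (n<2^1+⌊log₂n⌋ (n ℕ./ B)))

  2^L*B≤n : 1 ≤ k → 2 ℕ.^ L * B ≤ n
  2^L*B≤n 1≤k = ℕP.≤-trans (ℕP.*-monoˡ-≤ B (2^⌊log₂n⌋≤n (n ℕ./ B) (ℕP.≤-trans 1≤k k≤n/B))) (m/n*n≤m n B)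

  n≤2^1+L*B : n ≤ 2 ℕ.^ suc L * B
  n≤2^1+L*B = ℕP.≤-trans (ℕP.≤-reflexive (m≡m%n+[m/n]*n n B))
    (ℕP.≤-trans (ℕP.+-monoˡ-≤ (n ℕ./ B * B) (ℕP.<⇒≤ (m%n<n n B))) (ℕP.*-monoˡ-≤ B (n<2^1+⌊log₂n⌋ (n ℕ./ B))))

  1≤L : 2 ≤ k → 1 ≤ L
  1≤L 2≤k = ⌊log₂⌋-mono-≤ {2} {n ℕ./ B} (ℕP.≤-trans 2≤k k≤n/B)

  -- The 10 is `2 + 4 + 4`: heavy pairs cost `2/B`, the light parts of two rows `2 · 2(1 + L)/B`,
  -- and `1 ≤ L` absorbs the terms without `L`.
  upper-bound : 2 ≤ k → (i : Fin n) → expectedError n B k i ≤ℚ ι 10 *ℚ (ι L *ℚ recip B)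
  upper-bound 2≤k i = begin
    expectedError n B k i
      ≤⟨ expectedError≤ i 2≤k ⟩
    𝔼 (hashes n B) (λ h₁ → 𝔼 (hashes n B) (λ h₂ → load i h₁ ⊓ load i h₂))
      ≤⟨ 𝔼-load-⊓-load i ⟩
    ι 2 *ℚ p + ι 2 *ℚ (p *ℚ sum {n} (light B))
      ≤⟨ ℚP.+-monoʳ-≤ (ι 2 *ℚ p) (*-monoˡ (0≤ι 2) (*-monoˡ (0≤recip B) (sum-light n B (suc L) n≤2^1+L*B))) ⟩
    ι 2 *ℚ p + ι 2 *ℚ (p *ℚ (ι 2 *ℚ ι (suc L)))
      ≡⟨ solve 2 (λ p l → con (ι 2) :* p :+ con (ι 2) :* (p :* (con (ι 2) :* (con 1ℚ :+ l))) := con (ι 6) :* p :* con 1ℚ :+ con (ι 4) :* (l :* p)) refl p (ι L) ⟩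
    ι 6 *ℚ p *ℚ 1ℚ + ι 4 *ℚ (ι L *ℚ p)
      ≤⟨ ℚP.+-monoˡ-≤ (ι 4 *ℚ (ι L *ℚ p)) (*-monoˡ {ι 6 *ℚ p} {1ℚ} {ι L} (0≤* (0≤ι 6) (0≤recip B)) (ι-mono {1} {L} (1≤L 2≤k))) ⟩
    ι 6 *ℚ p *ℚ ι L + ι 4 *ℚ (ι L *ℚ p)
      ≡⟨ solve 2 (λ p l → con (ι 6) :* p :* l :+ con (ι 4) :* (l :* p) := con (ι 10) :* (l :* p)) refl p (ι L) ⟩
    ι 10 *ℚ (ι L *ℚ p) ∎
    where p = recip B

-- Lower bound

∧-⟦⟧ : ∀ b c → ⟦ b ∧ c ⟧ ≡ ⟦ c ⟧ *ℚ ⟦ b ⟧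
∧-⟦⟧ true  c = sym (ℚP.*-identityʳ ⟦ c ⟧)
∧-⟦⟧ false c = sym (ℚP.*-zeroʳ ⟦ c ⟧)

0≤product-if : ∀ {m w} → 0ℚ ≤ℚ w → (c : Fin m → Bool) → 0ℚ ≤ℚ product (λ j → if c j then w else 1ℚ)
0≤product-if {zero}  0≤w c = 0≤1
0≤product-if {suc m} 0≤w c with c zero
... | true  = 0≤* 0≤w (0≤product-if 0≤w (c ∘ suc))
... | false = 0≤* 0≤1 (0≤product-if 0≤w (c ∘ suc))

count-or-none : ∀ {m} (c : Fin m → Bool) → 1ℚ ≤ℚ sum (λ j → ⟦ c j ⟧) + product (λ j → if c j then 0ℚ else 1ℚ)
count-or-none {zero}  c = ℚP.≤-refl
count-or-none {suc m} c with c zero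
... | true  = begin
  1ℚ                  ≤⟨ p≤p+q (0≤sum (λ j → 0≤⟦⟧ (c (suc j)))) ⟩
  1ℚ + S              ≤⟨ p≤p+q (0≤* ℚP.≤-refl (0≤product-if ℚP.≤-refl (c ∘ suc))) ⟩
  1ℚ + S + 0ℚ *ℚ P    ∎
  where
  S = sum (λ j → ⟦ c (suc j) ⟧)
  P = product (λ j → if c (suc j) then 0ℚ else 1ℚ)
... | false = begin
  1ℚ                  ≤⟨ count-or-none (c ∘ suc) ⟩
  S + P               ≡⟨ solve 2 (λ s p → s :+ p := con 0ℚ :+ s :+ con 1ℚ :* p) refl S P ⟩
  0ℚ + S + 1ℚ *ℚ P    ∎
  where
  S = sum (λ j → ⟦ c (suc j) ⟧)
  P = product (λ j → if c (suc j) then 0ℚ else 1ℚ)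

-- Writing N for the number of true values of c, this is r ≤ N + 2^(r − N), the pointwise inequality behind a Chernoff bound.
count-or-few : ∀ {m} r (c : Fin m → Bool) →
               ι r ≤ℚ sum (λ j → ⟦ c j ⟧) + ι (2 ℕ.^ r) *ℚ product (λ j → if c j then ½ else 1ℚ)
count-or-few {zero} r c = begin
  ι r                            ≤⟨ ι-mono (ℕP.<⇒≤ (n<2^n r)) ⟩
  ι (2 ℕ.^ r)                    ≡⟨ solve 1 (λ x → x := con 0ℚ :+ x :* con 1ℚ) refl (ι (2 ℕ.^ r)) ⟩
  0ℚ + ι (2 ℕ.^ r) *ℚ 1ℚ         ∎
count-or-few {suc m} r c with c zero
count-or-few {suc m} r c | false = begin
  ι r                                 ≤⟨ count-or-few r (c ∘ suc) ⟩
  S + ι (2 ℕ.^ r) *ℚ P                ≡⟨ solve 3 (λ s t p → s :+ t :* p := con 0ℚ :+ s :+ t :* (con 1ℚ :* p)) refl S (ι (2 ℕ.^ r)) P ⟩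
  0ℚ + S + ι (2 ℕ.^ r) *ℚ (1ℚ *ℚ P)   ∎
  where
  S = sum (λ j → ⟦ c (suc j) ⟧)
  P = product (λ j → if c (suc j) then ½ else 1ℚ)
count-or-few {suc m} zero c | true = 0≤+ (0≤+ 0≤1 (0≤sum (λ j → 0≤⟦⟧ (c (suc j)))))
  (0≤* (0≤ι 1) (0≤* 0≤½ (0≤product-if 0≤½ (c ∘ suc))))
-- A true value lowers both `r` and `N` by one and leaves `2^(r − N)` unchanged: the factors 2 and ½
-- cancel.
count-or-few {suc m} (suc r) c | true = begin
  1ℚ + ι r
    ≤⟨ ℚP.+-monoʳ-≤ 1ℚ (count-or-few r (c ∘ suc)) ⟩
  1ℚ + (S + ι (2 ℕ.^ r) *ℚ P)
    ≡⟨ solve 3 (λ s t p → con 1ℚ :+ (s :+ t :* p) := con 1ℚ :+ s :+ con (ι 2) :* t :* (con ½ :* p)) refl S (ι (2 ℕ.^ r)) P ⟩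
  1ℚ + S + ι 2 *ℚ ι (2 ℕ.^ r) *ℚ (½ *ℚ P)
    ≡⟨ cong (λ t → 1ℚ + S + t *ℚ (½ *ℚ P)) (ι-* 2 (2 ℕ.^ r)) ⟨
  1ℚ + S + ι (2 ℕ.^ suc r) *ℚ (½ *ℚ P) ∎
  where
  S = sum (λ j → ⟦ c (suc j) ⟧)
  P = product (λ j → if c (suc j) then ½ else 1ℚ)

module _ {n B} .{{_ : NonZero B}} (i : Fin n) where

  private
    H = hashes n B
    p = recip B

  0≤hitWeight : ∀ {w} D (h : Hash n B) → 0ℚ ≤ℚ w → 0ℚ ≤ℚ hitWeight w D i h
  0≤hitWeight D h 0≤w = 0≤product-if 0≤w (λ j → (toℕ j ℕ.<ᵇ D) ∧ hit i h j)

  -- Any single hit is worth at least `1/n`, the smallest weight, so the defect of a row is `1/n`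
  -- times the indicator of no hit: `hitWeight` at `w = 0` and `D = n`.
  no-hit-bound : ∀ {k} → 1 ≤ k → recip n ≤ℚ expectedError n B k i + ι k *ℚ (recip n *ℚ (1ℚ - (1ℚ - 0ℚ) *ℚ p) ^ℚ (n ℕ.∸ 1))
  no-hit-bound {k} 1≤k = ℚP.≤-trans
    (≤expectedError i (λ h → 0≤* (0≤recip n) (0≤hitWeight n h ℚP.≤-refl)) some-hit 1≤k)
    (ℚP.+-monoʳ-≤ (expectedError n B k i) (*-monoˡ (0≤ι k)
      (ℚP.≤-trans (ℚP.≤-reflexive (𝔼-* H (recip n) (hitWeight 0ℚ n i)))
                  (*-monoˡ (0≤recip n) (𝔼-hitWeight i ℕP.≤-refl ℚP.≤-refl 0≤1)))))
    where
    some-hit : ∀ h → recip n ≤ℚ load i h + recip n *ℚ hitWeight 0ℚ n i h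
    some-hit h = begin
      recip n
        ≡⟨ ℚP.*-identityʳ (recip n) ⟨
      recip n *ℚ 1ℚ
        ≤⟨ *-monoˡ (0≤recip n) (count-or-none (λ j → (toℕ j ℕ.<ᵇ n) ∧ hit i h j)) ⟩
      recip n *ℚ (sum (λ j → ⟦ (toℕ j ℕ.<ᵇ n) ∧ hit i h j ⟧) + hitWeight 0ℚ n i h)
        ≡⟨ ℚP.*-distribˡ-+ (recip n) (sum (λ j → ⟦ (toℕ j ℕ.<ᵇ n) ∧ hit i h j ⟧)) (hitWeight 0ℚ n i h) ⟩
      recip n *ℚ sum (λ j → ⟦ (toℕ j ℕ.<ᵇ n) ∧ hit i h j ⟧) + recip n *ℚ hitWeight 0ℚ n i h
        ≡⟨ cong (_+ recip n *ℚ hitWeight 0ℚ n i h) (*-distribˡ-sum (recip n) (λ j → ⟦ (toℕ j ℕ.<ᵇ n) ∧ hit i h j ⟧)) ⟩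
      sum (λ j → recip n *ℚ ⟦ (toℕ j ℕ.<ᵇ n) ∧ hit i h j ⟧) + recip n *ℚ hitWeight 0ℚ n i h
        ≤⟨ ℚP.+-monoˡ-≤ (recip n *ℚ hitWeight 0ℚ n i h) (sum-mono term) ⟩
      load i h + recip n *ℚ hitWeight 0ℚ n i h ∎
      where
      term : ∀ j → recip n *ℚ ⟦ (toℕ j ℕ.<ᵇ n) ∧ hit i h j ⟧ ≤ℚ ⟦ hit i h j ⟧ *ℚ f j
      term j = begin
        recip n *ℚ ⟦ (toℕ j ℕ.<ᵇ n) ∧ hit i h j ⟧          ≡⟨ cong (recip n *ℚ_) (∧-⟦⟧ (toℕ j ℕ.<ᵇ n) (hit i h j)) ⟩
        recip n *ℚ (⟦ hit i h j ⟧ *ℚ below n (toℕ j))      ≡⟨ cong (λ b → recip n *ℚ (⟦ hit i h j ⟧ *ℚ b)) (below-yes (FP.toℕ<n j)) ⟩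
        recip n *ℚ (⟦ hit i h j ⟧ *ℚ 1ℚ)                   ≡⟨ solve 2 (λ r b → r :* (b :* con 1ℚ) := b :* r) refl (recip n) ⟦ hit i h j ⟧ ⟩
        ⟦ hit i h j ⟧ *ℚ recip n                           ≤⟨ *-monoˡ (0≤⟦⟧ (hit i h j)) (recip-anti (FP.toℕ<n j)) ⟩
        ⟦ hit i h j ⟧ *ℚ f j                               ∎

  -- The prefixes of sizes rc, 2rc, 4rc, … should contain at least r, 2r, 4r, … hits; deficit bounds what is missing.
  module _ (c : ℕ) .{{_ : NonZero c}} where

    deficit : ℕ → ℕ → Hash n B → ℚ
    deficit zero    r h = 0ℚ
    deficit (suc U) r h = recip (r * c) *ℚ (ι (2 ℕ.^ r) *ℚ hitWeight ½ (r * c) i h) + deficit U (2 * r) h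

    0≤deficit : ∀ U r h → 0ℚ ≤ℚ deficit U r h
    0≤deficit zero    r h = ℚP.≤-refl
    0≤deficit (suc U) r h = 0≤+ (0≤* (0≤recip (r * c)) (0≤* (0≤ι (2 ℕ.^ r)) (0≤hitWeight (r * c) h 0≤½))) (0≤deficit U (2 * r) h)

    -- Dividing `r ≤ C + 2^(r − C)` by the prefix size `rc` leaves `1/c`, independent of `r`: every
    -- scale contributes the same amount.
    dyadic-or-deficit : ∀ U r .{{_ : NonZero r}} h →
                        ι U *ℚ recip c ≤ℚ weightedHits i h (λ j → dyadic U (r * c) (toℕ j)) + deficit U r h
    dyadic-or-deficit zero r h = begin
      0ℚ *ℚ recip c                                    ≡⟨ ℚP.*-zeroˡ (recip c) ⟩
      0ℚ                                               ≤⟨ 0≤+ {weightedHits i h (λ _ → 0ℚ)} (0≤weightedHits i h (λ _ → ℚP.≤-refl)) ℚP.≤-refl ⟩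
      weightedHits i h (λ _ → 0ℚ) + 0ℚ                 ∎
    dyadic-or-deficit (suc U) r h = begin
      (1ℚ + ι U) *ℚ recip c
        ≡⟨ solve 2 (λ u q → (con 1ℚ :+ u) :* q := q :+ u :* q) refl (ι U) (recip c) ⟩
      recip c + ι U *ℚ recip c
        ≤⟨ ℚP.+-mono-≤ first rest ⟩
      (weightedHits i h (λ j → below D (toℕ j) *ℚ recip D) + recip D *ℚ W)
      + (weightedHits i h (λ j → dyadic U (2 * D) (toℕ j)) + deficit U (2 * r) h)
        ≡⟨ solve 4 (λ a b c d → a :+ b :+ (c :+ d) := a :+ c :+ (b :+ d)) refl
             (weightedHits i h (λ j → below D (toℕ j) *ℚ recip D)) (recip D *ℚ W)
             (weightedHits i h (λ j → dyadic U (2 * D) (toℕ j))) (deficit U (2 * r) h) ⟩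
      (weightedHits i h (λ j → below D (toℕ j) *ℚ recip D) + weightedHits i h (λ j → dyadic U (2 * D) (toℕ j)))
      + deficit (suc U) r h
        ≡⟨ cong (_+ deficit (suc U) r h) (weightedHits-+ i h (λ j → below D (toℕ j) *ℚ recip D) (λ j → dyadic U (2 * D) (toℕ j))) ⟨
      weightedHits i h (λ j → dyadic (suc U) D (toℕ j)) + deficit (suc U) r h ∎
      where
      D = r * c
      W = ι (2 ℕ.^ r) *ℚ hitWeight ½ D i h
      rest : ι U *ℚ recip c ≤ℚ weightedHits i h (λ j → dyadic U (2 * D) (toℕ j)) + deficit U (2 * r) h
      rest = subst (λ D′ → ι U *ℚ recip c ≤ℚ weightedHits i h (λ j → dyadic U D′ (toℕ j)) + deficit U (2 * r) h)
        (ℕP.*-assoc 2 r c) (dyadic-or-deficit U (2 * r) {{ℕP.m*n≢0 2 r}} h)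
      first : recip c ≤ℚ weightedHits i h (λ j → below D (toℕ j) *ℚ recip D) + recip D *ℚ W
      first = begin
        recip c
          ≡⟨ ℚP.*-identityˡ (recip c) ⟨
        1ℚ *ℚ recip c
          ≡⟨ cong (_*ℚ recip c) (ι*recip r) ⟨
        ι r *ℚ recip r *ℚ recip c
          ≡⟨ trans (ℚP.*-assoc (ι r) (recip r) (recip c)) (cong (ι r *ℚ_) (sym (recip-* r c))) ⟩
        ι r *ℚ recip D
          ≡⟨ ℚP.*-comm (ι r) (recip D) ⟩
        recip D *ℚ ι r
          ≤⟨ *-monoˡ (0≤recip D) (count-or-few r (λ j → (toℕ j ℕ.<ᵇ D) ∧ hit i h j)) ⟩
        recip D *ℚ (sum (λ j → ⟦ (toℕ j ℕ.<ᵇ D) ∧ hit i h j ⟧) + W)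
          ≡⟨ ℚP.*-distribˡ-+ (recip D) (sum (λ j → ⟦ (toℕ j ℕ.<ᵇ D) ∧ hit i h j ⟧)) W ⟩
        recip D *ℚ sum (λ j → ⟦ (toℕ j ℕ.<ᵇ D) ∧ hit i h j ⟧) + recip D *ℚ W
          ≡⟨ cong (_+ recip D *ℚ W) (trans (*-distribˡ-sum (recip D) (λ j → ⟦ (toℕ j ℕ.<ᵇ D) ∧ hit i h j ⟧)) (sum-cong-≗ term)) ⟩
        weightedHits i h (λ j → below D (toℕ j) *ℚ recip D) + recip D *ℚ W ∎
        where
        term : ∀ j → recip D *ℚ ⟦ (toℕ j ℕ.<ᵇ D) ∧ hit i h j ⟧ ≡ ⟦ hit i h j ⟧ *ℚ (below D (toℕ j) *ℚ recip D)
        term j = trans (cong (recip D *ℚ_) (∧-⟦⟧ (toℕ j ℕ.<ᵇ D) (hit i h j)))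
          (solve 3 (λ r x b → r :* (x :* b) := x :* (b :* r)) refl (recip D) ⟦ hit i h j ⟧ (below D (toℕ j)))

    module _ {e : ℚ} {r₀ : ℕ} (r₀≢0 : NonZero r₀)
             (tail : ∀ r → r₀ ≤ r → ι (2 ℕ.^ r) *ℚ (1ℚ - (1ℚ - ½) *ℚ p) ^ℚ (r * c ℕ.∸ 1) ≤ℚ e) where

      -- Each scale costs at most `e/(rc)`, and the gain `1/r` is given away. `fits` keeps the
      -- prefixes within `n`, as `𝔼-hitWeight` demands.
      𝔼-deficit : ∀ U r → r₀ ≤ r → 2 ℕ.^ U * (r * c) ≤ n → 𝔼 H (deficit U r) ≤ℚ ι U *ℚ (recip c *ℚ e)
      𝔼-deficit zero r r₀≤r fits = ℚP.≤-reflexive (trans (𝔼-hash-const n 0ℚ) (sym (ℚP.*-zeroˡ (recip c *ℚ e))))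
      𝔼-deficit (suc U) r r₀≤r fits = begin
        𝔼 H (deficit (suc U) r)
          ≡⟨ 𝔼-+ H (λ h → recip D *ℚ (ι (2 ℕ.^ r) *ℚ hitWeight ½ D i h)) (deficit U (2 * r)) ⟩
        𝔼 H (λ h → recip D *ℚ (ι (2 ℕ.^ r) *ℚ hitWeight ½ D i h)) + 𝔼 H (deficit U (2 * r))
          ≡⟨ cong (_+ 𝔼 H (deficit U (2 * r))) (trans (𝔼-* H (recip D) _) (cong (recip D *ℚ_) (𝔼-* H (ι (2 ℕ.^ r)) (hitWeight ½ D i)))) ⟩
        recip D *ℚ (ι (2 ℕ.^ r) *ℚ 𝔼 H (hitWeight ½ D i)) + 𝔼 H (deficit U (2 * r))
          ≤⟨ ℚP.+-mono-≤ (*-mono (0≤* (0≤ι (2 ℕ.^ r)) 0≤𝔼) (0≤recip c) (recip-anti {c} {D} (ℕP.m≤n*m c r {{r≢0}})) level) rest ⟩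
        recip c *ℚ e + ι U *ℚ (recip c *ℚ e)
          ≡⟨ solve 2 (λ x u → x :+ u :* x := (con 1ℚ :+ u) :* x) refl (recip c *ℚ e) (ι U) ⟩
        ι (suc U) *ℚ (recip c *ℚ e) ∎
        where
        D = r * c
        r≢0 : NonZero r
        r≢0 = ℕ.>-nonZero (ℕP.≤-trans (ℕ.>-nonZero⁻¹ r₀ {{r₀≢0}}) r₀≤r)
        0≤𝔼 : 0ℚ ≤ℚ 𝔼 H (hitWeight ½ D i)
        0≤𝔼 = ℚP.≤-trans (ℚP.≤-reflexive (sym (𝔼-hash-const n 0ℚ))) (𝔼-mono H (λ h → 0≤hitWeight D h 0≤½))
        D≤n : D ≤ n
        D≤n = ℕP.≤-trans (ℕP.m≤n*m D (2 ℕ.^ suc U) {{ℕP.m^n≢0 2 (suc U)}}) fits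
        level : ι (2 ℕ.^ r) *ℚ 𝔼 H (hitWeight ½ D i) ≤ℚ e
        level = ℚP.≤-trans (*-monoˡ (0≤ι (2 ℕ.^ r)) (𝔼-hitWeight i D≤n 0≤½ ½≤1)) (tail r r₀≤r)
        reassoc : 2 ℕ.^ suc U * D ≡ 2 ℕ.^ U * (2 * r * c)
        reassoc = trans (cong (_* D) (ℕP.*-comm 2 (2 ℕ.^ U))) (trans (ℕP.*-assoc (2 ℕ.^ U) 2 D) (cong (2 ℕ.^ U *_) (sym (ℕP.*-assoc 2 r c))))
        rest : 𝔼 H (deficit U (2 * r)) ≤ℚ ι U *ℚ (recip c *ℚ e)
        rest = 𝔼-deficit U (2 * r) (ℕP.≤-trans r₀≤r (ℕP.m≤n*m r 2)) (subst (_≤ n) reassoc fits)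

      -- The factor ½ pays for `dyadic≤`, where the dyadic weights may be twice the harmonic ones.
      dyadic-bound : ∀ U {k} → 1 ≤ k → 2 ℕ.^ U * (r₀ * c) ≤ n →
                     ½ *ℚ (ι U *ℚ recip c) ≤ℚ expectedError n B k i + ι k *ℚ (½ *ℚ (ι U *ℚ (recip c *ℚ e)))
      dyadic-bound U {k} 1≤k fits = ℚP.≤-trans
        (≤expectedError i (λ h → 0≤* 0≤½ (0≤deficit U r₀ h)) half 1≤k)
        (ℚP.+-monoʳ-≤ (expectedError n B k i) (*-monoˡ (0≤ι k)
          (ℚP.≤-trans (ℚP.≤-reflexive (𝔼-* H ½ (deficit U r₀))) (*-monoˡ 0≤½ (𝔼-deficit U r₀ ℕP.≤-refl fits)))))
        where
        half : ∀ h → ½ *ℚ (ι U *ℚ recip c) ≤ℚ load i h + ½ *ℚ deficit U r₀ h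
        half h = begin
          ½ *ℚ (ι U *ℚ recip c)
            ≤⟨ *-monoˡ 0≤½ (dyadic-or-deficit U r₀ {{r₀≢0}} h) ⟩
          ½ *ℚ (weightedHits i h (λ j → dyadic U (r₀ * c) (toℕ j)) + deficit U r₀ h)
            ≤⟨ *-monoˡ 0≤½ (ℚP.+-monoˡ-≤ (deficit U r₀ h) (weightedHits-mono i h (λ j → dyadic≤ U (r₀ * c) (toℕ j)))) ⟩
          ½ *ℚ (weightedHits i h (λ j → ι 2 *ℚ f j) + deficit U r₀ h)
            ≡⟨ cong (λ x → ½ *ℚ (x + deficit U r₀ h)) doubled ⟩
          ½ *ℚ (ι 2 *ℚ load i h + deficit U r₀ h)
            ≡⟨ solve 2 (λ l d → con ½ :* (con (ι 2) :* l :+ d) := l :+ con ½ :* d) refl (load i h) (deficit U r₀ h) ⟩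
          load i h + ½ *ℚ deficit U r₀ h ∎
          where
          doubled : weightedHits i h (λ j → ι 2 *ℚ f j) ≡ ι 2 *ℚ load i h
          doubled = trans (sum-cong-≗ (λ j → solve 2 (λ b x → b :* (con (ι 2) :* x) := con (ι 2) :* (b :* x)) refl ⟦ hit i h j ⟧ (f j)))
            (sym (*-distribˡ-sum (ι 2) (λ j → ⟦ hit i h j ⟧ *ℚ f j)))

-- Numerical tail estimates

⅓ ⅔ : ℚ
⅓ = ℤ.+ 1 / 3
⅔ = ℤ.+ 2 / 3

0≤⅔ : 0ℚ ≤ℚ ⅔
0≤⅔ = from-yes (0ℚ ℚ.≤? ⅔)

≤⅔ : ∀ {y} → y *ℚ (1ℚ + ½) ≤ℚ 1ℚ → y ≤ℚ ⅔
≤⅔ {y} le = begin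
  y                        ≡⟨ ℚP.*-identityʳ y ⟨
  y *ℚ ((1ℚ + ½) *ℚ ⅔)     ≡⟨ ℚP.*-assoc y (1ℚ + ½) ⅔ ⟨
  y *ℚ (1ℚ + ½) *ℚ ⅔       ≤⟨ *-monoʳ 0≤⅔ le ⟩
  1ℚ *ℚ ⅔                  ≡⟨ ℚP.*-identityˡ ⅔ ⟩
  ⅔                        ∎

≤½ : ∀ {y} → y *ℚ ι 2 ≤ℚ 1ℚ → y ≤ℚ ½
≤½ {y} le = begin
  y                 ≡⟨ ℚP.*-identityʳ y ⟨
  y *ℚ (ι 2 *ℚ ½)   ≡⟨ ℚP.*-assoc y (ι 2) ½ ⟨
  y *ℚ ι 2 *ℚ ½     ≤⟨ *-monoʳ 0≤½ le ⟩
  1ℚ *ℚ ½           ≡⟨ ℚP.*-identityˡ ½ ⟩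
  ½                 ∎

-- Restores the exponent lost to the exclusion of `i`, at the price of a factor 2.
^-pred : ∀ {x} m → ½ ≤ℚ x → x ^ℚ (m ℕ.∸ 1) ≤ℚ ι 2 *ℚ x ^ℚ m
^-pred zero    ½≤x = from-yes (1ℚ ℚ.≤? ι 2 *ℚ 1ℚ)
^-pred {x} (suc m) ½≤x = begin
  x ^ℚ m                       ≡⟨ solve 1 (λ y → y := con (ι 2) :* (con ½ :* y)) refl (x ^ℚ m) ⟩
  ι 2 *ℚ (½ *ℚ x ^ℚ m)         ≤⟨ *-monoˡ (0≤ι 2) (*-monoʳ (0≤^ m (ℚP.≤-trans 0≤½ ½≤x)) ½≤x) ⟩
  ι 2 *ℚ (x *ℚ x ^ℚ m)         ∎

^-* : ∀ x m n → x ^ℚ (m * n) ≡ (x ^ℚ n) ^ℚ m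
^-* x m n = trans (cong (x ^ℚ_) (ℕP.*-comm m n)) (sym (^-assocʳ x n m))

module _ (B : ℕ) .{{_ : NonZero B}} where

  private
    p = recip B
    x = 1ℚ - (1ℚ - ½) *ℚ p

    0≤p/2 : 0ℚ ≤ℚ ½ *ℚ p
    0≤p/2 = 0≤* 0≤½ (0≤recip B)

    p/2≤½ : ½ *ℚ p ≤ℚ ½
    p/2≤½ = *-monoˡ {½} {p} {1ℚ} 0≤½ (recip≤1 B)

    ½≤x : ½ ≤ℚ x
    ½≤x = ℚP.+-monoʳ-≤ 1ℚ (ℚP.neg-antimono-≤ p/2≤½)

    x^B≤⅔ : x ^ℚ B ≤ℚ ⅔
    x^B≤⅔ = ≤⅔ (begin
      x ^ℚ B *ℚ (1ℚ + ½)                   ≡⟨ cong (λ u → x ^ℚ B *ℚ (1ℚ + ½ *ℚ u)) (ι*recip B) ⟨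
      x ^ℚ B *ℚ (1ℚ + ½ *ℚ (ι B *ℚ p))     ≡⟨ cong (λ u → x ^ℚ B *ℚ (1ℚ + u)) (solve 2 (λ b p → con ½ :* (b :* p) := b :* (con ½ :* p)) refl (ι B) p) ⟩
      x ^ℚ B *ℚ (1ℚ + ι B *ℚ (½ *ℚ p))     ≤⟨ bernoulli B 0≤p/2 (ℚP.≤-trans p/2≤½ ½≤1) ⟩
      1ℚ                                   ∎)

    0≤x : 0ℚ ≤ℚ x
    0≤x = ℚP.≤-trans 0≤½ ½≤x

    -- The origin of the 4 in the prefix size `4rB`: the fourth power is the first power of `⅔`
    -- below ¼.
    x^4B≤¼ : x ^ℚ (4 * B) ≤ℚ ½ *ℚ ½
    x^4B≤¼ = begin
      x ^ℚ (4 * B)       ≡⟨ ^-* x 4 B ⟩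
      (x ^ℚ B) ^ℚ 4      ≤⟨ ^-monoˡ 4 (0≤^ B 0≤x) x^B≤⅔ ⟩
      ⅔ ^ℚ 4             ≤⟨ from-yes (⅔ ^ℚ 4 ℚ.≤? ½ *ℚ ½) ⟩
      ½ *ℚ ½             ∎

  -- Of the decay `4^(−r)`, one factor `2^(−r)` cancels the Chernoff factor `2^r`; the other remains
  -- to beat the number of rows.
  few-hits-tail : ∀ r → ι (2 ℕ.^ r) *ℚ x ^ℚ (r * (4 * B) ℕ.∸ 1) ≤ℚ ι 2 *ℚ ½ ^ℚ r
  few-hits-tail r = begin
    t *ℚ x ^ℚ (r * (4 * B) ℕ.∸ 1)           ≤⟨ *-monoˡ (0≤ι (2 ℕ.^ r)) (^-pred (r * (4 * B)) ½≤x) ⟩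
    t *ℚ (ι 2 *ℚ x ^ℚ (r * (4 * B)))        ≡⟨ cong (λ y → t *ℚ (ι 2 *ℚ y)) (^-* x r (4 * B)) ⟩
    t *ℚ (ι 2 *ℚ (x ^ℚ (4 * B)) ^ℚ r)       ≤⟨ *-monoˡ (0≤ι (2 ℕ.^ r)) (*-monoˡ (0≤ι 2) (^-monoˡ r (0≤^ (4 * B) 0≤x) x^4B≤¼)) ⟩
    t *ℚ (ι 2 *ℚ (½ *ℚ ½) ^ℚ r)             ≡⟨ cong (λ y → t *ℚ (ι 2 *ℚ y)) (^-distrib-* ½ ½ r) ⟩
    t *ℚ (ι 2 *ℚ (½ ^ℚ r *ℚ ½ ^ℚ r))        ≡⟨ solve 2 (λ t h → t :* (con (ι 2) :* (h :* h)) := con (ι 2) :* ((t :* h) :* h)) refl t (½ ^ℚ r) ⟩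
    ι 2 *ℚ (t *ℚ ½ ^ℚ r *ℚ ½ ^ℚ r)          ≡⟨ cong (λ u → ι 2 *ℚ (u *ℚ ½ ^ℚ r)) (2^*½^ r) ⟩
    ι 2 *ℚ (1ℚ *ℚ ½ ^ℚ r)                   ≡⟨ cong (ι 2 *ℚ_) (ℚP.*-identityˡ (½ ^ℚ r)) ⟩
    ι 2 *ℚ ½ ^ℚ r                           ∎
    where t = ι (2 ℕ.^ r)

-- The exponent is at least `kB − 1 = (B − 1) + (k − 1)B`. The `k − 1` full blocks give ½ each,
-- which beats `k ≤ 2^(k−1)`; the incomplete block gives `⅔` because `(B − 1)/B ≥ ½`. For `B = 1`
-- the base is 0 and `n ≥ k ≥ 2` makes the exponent positive.
no-hit-tail : ∀ n B k .{{_ : NonZero B}} → 2 ≤ k → k * B ≤ n → ι k *ℚ (1ℚ - (1ℚ - 0ℚ) *ℚ recip B) ^ℚ (n ℕ.∸ 1) ≤ℚ ⅔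
no-hit-tail (suc (suc n)) 1 k 2≤k k≤n = begin
  ι k *ℚ (0ℚ *ℚ 0ℚ ^ℚ n)     ≡⟨ solve 2 (λ k y → k :* (con 0ℚ :* y) := con 0ℚ) refl (ι k) (0ℚ ^ℚ n) ⟩
  0ℚ                         ≤⟨ 0≤⅔ ⟩
  ⅔                          ∎
no-hit-tail zero 1 (suc (suc k)) 2≤k ()
no-hit-tail (suc zero) 1 (suc (suc k)) 2≤k (s≤s ())
no-hit-tail (suc zero) 1 (suc zero) (s≤s ()) _
no-hit-tail n B@(suc b@(suc _)) k@(suc k′) 2≤k kB≤n = begin
  ι k *ℚ (1ℚ - 1ℚ *ℚ p) ^ℚ (n ℕ.∸ 1)     ≡⟨ cong (λ u → ι k *ℚ (1ℚ - u) ^ℚ (n ℕ.∸ 1)) (ℚP.*-identityˡ p) ⟩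
  ι k *ℚ x ^ℚ (n ℕ.∸ 1)                  ≤⟨ *-monoˡ (0≤ι k) (^-anti 0≤x (p-q≤p 1ℚ (0≤recip B)) (ℕP.∸-monoˡ-≤ 1 kB≤n)) ⟩
  ι k *ℚ x ^ℚ (b ℕ.+ k′ * B)             ≡⟨ cong (ι k *ℚ_) (trans (^-homo-* x b (k′ * B)) (cong (x ^ℚ b *ℚ_) (^-* x k′ B))) ⟩
  ι k *ℚ (x ^ℚ b *ℚ (x ^ℚ B) ^ℚ k′)      ≤⟨ *-mono (0≤* (0≤^ b 0≤x) (0≤^ k′ (0≤^ B 0≤x))) (0≤ι (2 ℕ.^ k′)) (ι-mono (n<2^n k′))
                                              (*-mono (0≤^ k′ (0≤^ B 0≤x)) 0≤⅔ x^b≤⅔ (^-monoˡ k′ (0≤^ B 0≤x) x^B≤½)) ⟩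
  ι (2 ℕ.^ k′) *ℚ (⅔ *ℚ ½ ^ℚ k′)         ≡⟨ solve 2 (λ t h → t :* (con ⅔ :* h) := con ⅔ :* (t :* h)) refl (ι (2 ℕ.^ k′)) (½ ^ℚ k′) ⟩
  ⅔ *ℚ (ι (2 ℕ.^ k′) *ℚ ½ ^ℚ k′)         ≡⟨ cong (⅔ *ℚ_) (2^*½^ k′) ⟩
  ⅔ *ℚ 1ℚ                                ≡⟨ ℚP.*-identityʳ ⅔ ⟩
  ⅔                                      ∎
  where
  p = recip B
  x = 1ℚ - p
  0≤x : 0ℚ ≤ℚ x
  0≤x = p≤q⇒0≤q-p (recip≤1 B)
  x^B≤½ : x ^ℚ B ≤ℚ ½
  x^B≤½ = ≤½ (begin
    x ^ℚ B *ℚ (1ℚ + 1ℚ)          ≡⟨ cong (λ u → x ^ℚ B *ℚ (1ℚ + u)) (ι*recip B) ⟨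
    x ^ℚ B *ℚ (1ℚ + ι B *ℚ p)    ≤⟨ bernoulli B (0≤recip B) (recip≤1 B) ⟩
    1ℚ                           ∎)
  ½≤bp : ½ ≤ℚ ι b *ℚ p
  ½≤bp = begin
    ½                        ≤⟨ ℚP.+-monoʳ-≤ 1ℚ (ℚP.neg-antimono-≤ (recip-anti {2} {B} (s≤s (s≤s z≤n)))) ⟩
    1ℚ - p                   ≡⟨ cong (_- p) (ι*recip B) ⟨
    (1ℚ + ι b) *ℚ p - p      ≡⟨ solve 2 (λ b p → (con 1ℚ :+ b) :* p :- p := b :* p) refl (ι b) p ⟩
    ι b *ℚ p                 ∎
  x^b≤⅔ : x ^ℚ b ≤ℚ ⅔
  x^b≤⅔ = ≤⅔ (ℚP.≤-trans (*-monoˡ (0≤^ b 0≤x) (ℚP.+-monoʳ-≤ 1ℚ ½≤bp)) (bernoulli b (0≤recip B) (recip≤1 B)))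

-- The largest power of two, `2^(−18)`, with `11 c₀ ≤ 1/(3 · 4096)`, as small `L` requires; large
-- `L` asks only for `3 c₀ ≤ 1/16`.
c₀ : ℚ
c₀ = ℤ.+ 1 / 262144

0≤c₀ : 0ℚ ≤ℚ c₀
0≤c₀ = 0≤recip 262144

-- The lower bound for bounded and for large n/B

module _ {n B k : ℕ} .{{_ : NonZero B}} (2≤k : 2 ≤ k) (kB≤n : k * B ≤ n) (i : Fin n) where

  private
    L = ⌊log₂ n ℕ./ B ⌋
    p = recip B
    E = expectedError n B k i

    1≤k : 1 ≤ k
    1≤k = ℕP.≤-trans (s≤s z≤n) 2≤k

  -- For `n ≤ 2^12 B` the value `1/n` of a lone hit is of order `1/B`; the no-hit event takes at
  -- most `⅔` of it, so `1/(3n)` is left.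
  lower-bound-small : L ≤ 11 → c₀ *ℚ (ι L *ℚ p) ≤ℚ E
  lower-bound-small L≤11 = begin
    c₀ *ℚ (ι L *ℚ p)                     ≤⟨ *-monoˡ 0≤c₀ (*-monoʳ (0≤recip B) (ι-mono L≤11)) ⟩
    c₀ *ℚ (ι 11 *ℚ p)                    ≡⟨ ℚP.*-assoc c₀ (ι 11) p ⟨
    c₀ *ℚ ι 11 *ℚ p                      ≤⟨ *-monoʳ (0≤recip B) (from-yes (c₀ *ℚ ι 11 ℚ.≤? ⅓ *ℚ recip 4096)) ⟩
    ⅓ *ℚ recip 4096 *ℚ p                 ≡⟨ ℚP.*-assoc ⅓ (recip 4096) p ⟩
    ⅓ *ℚ (recip 4096 *ℚ p)               ≡⟨ cong (⅓ *ℚ_) (recip-* 4096 B) ⟨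
    ⅓ *ℚ recip (4096 * B)                ≤⟨ *-monoˡ {⅓} (from-yes (0ℚ ℚ.≤? ⅓)) (recip-anti {{FP.nonZeroIndex i}} n≤4096B) ⟩
    ⅓ *ℚ recip n                         ≡⟨ solve 1 (λ r → con ⅓ :* r := r :- r :* con ⅔) refl (recip n) ⟩
    recip n - recip n *ℚ ⅔               ≤⟨ ≤+⇒-≤ {recip n} {E} {recip n *ℚ ⅔} bound ⟩
    E                                    ∎
    where
    n≤4096B : n ≤ 4096 * B
    n≤4096B = ℕP.≤-trans (n≤2^1+L*B {n} {B} {k} kB≤n) (ℕP.*-monoˡ-≤ B (ℕP.^-monoʳ-≤ 2 (s≤s L≤11)))
    y = (1ℚ - (1ℚ - 0ℚ) *ℚ p) ^ℚ (n ℕ.∸ 1)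
    bound : recip n ≤ℚ E + recip n *ℚ ⅔
    bound = begin
      recip n                          ≤⟨ no-hit-bound i 1≤k ⟩
      E + ι k *ℚ (recip n *ℚ y)        ≡⟨ cong (E +_) (solve 3 (λ k r y → k :* (r :* y) := r :* (k :* y)) refl (ι k) (recip n) y) ⟩
      E + recip n *ℚ (ι k *ℚ y)        ≤⟨ ℚP.+-monoʳ-≤ E (*-monoˡ (0≤recip n) (no-hit-tail n B k 2≤k kB≤n)) ⟩
      E + recip n *ℚ ⅔                 ∎

  lower-bound-large : 12 ≤ L → c₀ *ℚ (ι L *ℚ p) ≤ℚ E
  lower-bound-large 12≤L = begin
    c₀ *ℚ (ι L *ℚ p)                          ≤⟨ *-monoˡ 0≤c₀ (*-monoʳ (0≤recip B) (ι-mono L≤3l)) ⟩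
    c₀ *ℚ (ι (3 * l) *ℚ p)                    ≡⟨ cong (λ u → c₀ *ℚ (u *ℚ p)) (ι-* 3 l) ⟩
    c₀ *ℚ (ι 3 *ℚ ι l *ℚ p)                   ≡⟨ solve 2 (λ l p → con c₀ :* (con (ι 3) :* l :* p) := con (c₀ *ℚ ι 3) :* (l :* p)) refl (ι l) p ⟩
    c₀ *ℚ ι 3 *ℚ (ι l *ℚ p)                   ≤⟨ *-monoʳ (0≤* (0≤ι l) (0≤recip B)) (from-yes (c₀ *ℚ ι 3 ℚ.≤? recip 16)) ⟩
    recip 16 *ℚ (ι l *ℚ p)                    ≡⟨ solve 2 (λ l p → con (recip 16) :* (l :* p) := con (½ *ℚ ½) :* (l :* (con (recip 4) :* p))) refl (ι l) p ⟩
    ½ *ℚ ½ *ℚ (ι l *ℚ (recip 4 *ℚ p))         ≡⟨ cong (λ q → ½ *ℚ ½ *ℚ (ι l *ℚ q)) (recip-* 4 B) ⟨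
    ½ *ℚ ½ *ℚ Y                               ≡⟨ solve 1 (λ y → con (½ *ℚ ½) :* y := con ½ :* y :- con ½ :* y :* con ½) refl Y ⟩
    ½ *ℚ Y - ½ *ℚ Y *ℚ ½                      ≤⟨ ≤+⇒-≤ {½ *ℚ Y} {E} {½ *ℚ Y *ℚ ½} bound ⟩
    E                                         ∎
    where
    -- Half of the doublings serve as scales; the other half leaves room for the first prefix, of
    -- size `4 r₀ B`.
    l = L ℕ./ 2
    -- Chosen so that `r₀ ≥ L + 3`; then `k e ≤ 2^(1+L) · 2 · 2^(−L−3) = ½`.
    r₀ = l * 2 ℕ.+ 4
    e = ι 2 *ℚ ½ ^ℚ r₀
    q = recip (4 * B)
    Y = ι l *ℚ q
    L≤1+2l : L ≤ 1 ℕ.+ l * 2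
    L≤1+2l = ℕP.≤-trans (ℕP.≤-reflexive (m≡m%n+[m/n]*n L 2)) (ℕP.+-monoˡ-≤ (l * 2) (ℕP.≤-pred (m%n<n L 2)))
    6≤l : 6 ≤ l
    6≤l = /-monoˡ-≤ 2 12≤L
    L≤3l : L ≤ 3 * l
    L≤3l = ℕP.≤-trans L≤1+2l (ℕP.+-mono-≤ (ℕP.≤-trans (s≤s z≤n) 6≤l) (ℕP.≤-reflexive (ℕP.*-comm l 2)))
    -- At `m = 6` both sides are 64, hence the case split at `L = 12`; from there on the left grows
    -- by 8 while the right doubles.
    room : ∀ m → 6 ≤ m → (m * 2 ℕ.+ 4) * 4 ≤ 2 ℕ.^ m
    room m 6≤m = subst (λ m → (m * 2 ℕ.+ 4) * 4 ≤ 2 ℕ.^ m) (ℕP.m+[n∸m]≡n 6≤m) (from-6 (m ℕ.∸ 6))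
      where
      from-6 : ∀ d → ((6 ℕ.+ d) * 2 ℕ.+ 4) * 4 ≤ 2 ℕ.^ (6 ℕ.+ d)
      from-6 zero    = ℕP.≤-refl
      from-6 (suc d) = subst (λ m → (m * 2 ℕ.+ 4) * 4 ≤ 2 ℕ.^ m) (sym (ℕP.+-suc 6 d))
        (ℕP.+-mono-≤ {8} {2 ℕ.^ (6 ℕ.+ d)} (ℕP.^-monoʳ-≤ 2 {3} {6 ℕ.+ d} (s≤s (s≤s (s≤s z≤n))))
          (ℕP.≤-trans (from-6 d) (ℕP.≤-reflexive (sym (ℕP.+-identityʳ (2 ℕ.^ (6 ℕ.+ d)))))))
    fits : 2 ℕ.^ l * (r₀ * (4 * B)) ≤ n
    fits = R.begin
      2 ℕ.^ l * (r₀ * (4 * B))        R.≡⟨ cong (2 ℕ.^ l *_) (ℕP.*-assoc r₀ 4 B) ⟨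
      2 ℕ.^ l * (r₀ * 4 * B)          R.≤⟨ ℕP.*-monoʳ-≤ (2 ℕ.^ l) (ℕP.*-monoˡ-≤ B (room l 6≤l)) ⟩
      2 ℕ.^ l * (2 ℕ.^ l * B)         R.≡⟨ ℕP.*-assoc (2 ℕ.^ l) (2 ℕ.^ l) B ⟨
      2 ℕ.^ l * 2 ℕ.^ l * B           R.≡⟨ cong (_* B) (ℕP.^-distribˡ-+-* 2 l l) ⟨
      2 ℕ.^ (l ℕ.+ l) * B             R.≤⟨ ℕP.*-monoˡ-≤ B (ℕP.^-monoʳ-≤ 2 2l≤L) ⟩
      2 ℕ.^ L * B                     R.≤⟨ 2^L*B≤n {n} {B} {k} kB≤n 1≤k ⟩
      n                               R.∎
      where
      module R = ℕP.≤-Reasoning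
      2l≤L : l ℕ.+ l ≤ L
      2l≤L = subst (_≤ L) (trans (ℕP.*-comm l 2) (cong (l ℕ.+_) (ℕP.+-identityʳ l))) (m/n*n≤m L 2)
    r₀≢0 : NonZero r₀
    r₀≢0 = ℕ.>-nonZero (ℕP.≤-trans (s≤s z≤n) (ℕP.m≤n+m 4 (l * 2)))
    tail : ∀ r → r₀ ≤ r → ι (2 ℕ.^ r) *ℚ (1ℚ - (1ℚ - ½) *ℚ p) ^ℚ (r * (4 * B) ℕ.∸ 1) ≤ℚ e
    tail r r₀≤r = ℚP.≤-trans (few-hits-tail B r) (*-monoˡ (0≤ι 2) (^-anti 0≤½ ½≤1 r₀≤r))
    ke≤½ : ι k *ℚ e ≤ℚ ½
    ke≤½ = begin
      ι k *ℚ (ι 2 *ℚ ½ ^ℚ r₀)                             ≤⟨ *-mono (0≤* (0≤ι 2) (0≤^ r₀ 0≤½)) (0≤ι (2 ℕ.^ suc L)) (ι-mono (k≤2^1+L {n} {B} {k} kB≤n))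
                                                              (*-monoˡ (0≤ι 2) (^-anti 0≤½ ½≤1 3+L≤r₀)) ⟩
      ι (2 ℕ.^ suc L) *ℚ (ι 2 *ℚ (½ *ℚ (½ *ℚ h)))         ≡⟨ solve 2 (λ t h → t :* (con (ι 2) :* (con ½ :* (con ½ :* h))) := con ½ :* (t :* h)) refl (ι (2 ℕ.^ suc L)) h ⟩
      ½ *ℚ (ι (2 ℕ.^ suc L) *ℚ h)                         ≡⟨ cong (½ *ℚ_) (2^*½^ (suc L)) ⟩
      ½                                                   ∎
      where
      h = ½ ^ℚ suc L
      3+L≤r₀ : 3 ℕ.+ L ≤ r₀
      3+L≤r₀ = ℕP.≤-trans (ℕP.+-monoʳ-≤ 3 L≤1+2l) (ℕP.≤-reflexive (ℕP.+-comm 4 (l * 2)))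
    bound : ½ *ℚ Y ≤ℚ E + ½ *ℚ Y *ℚ ½
    bound = begin
      ½ *ℚ Y                                          ≤⟨ dyadic-bound i (4 * B) {{ℕP.m*n≢0 4 B}} r₀≢0 tail l 1≤k fits ⟩
      E + ι k *ℚ (½ *ℚ (ι l *ℚ (q *ℚ e)))             ≡⟨ cong (E +_) (solve 4 (λ k l q e → k :* (con ½ :* (l :* (q :* e))) := con ½ :* (l :* q) :* (k :* e)) refl (ι k) (ι l) q e) ⟩
      E + ½ *ℚ Y *ℚ (ι k *ℚ e)                        ≤⟨ ℚP.+-monoʳ-≤ E (*-monoˡ {½ *ℚ Y} (0≤* 0≤½ (0≤* (0≤ι l) (0≤recip (4 * B)))) ke≤½) ⟩
      E + ½ *ℚ Y *ℚ ½                                 ∎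

  lower-bound : c₀ *ℚ (ι L *ℚ p) ≤ℚ E
  lower-bound = [ (λ 12≤L → lower-bound-large 12≤L) , (λ L<12 → lower-bound-small (ℕP.≤-pred L<12)) ]′ (ℕP.≤-<-connex 12 L)

theorem5 : Σ ℚ λ c → Σ ℚ λ C → (0ℚ <ℚ c) × (0ℚ <ℚ C) ×
    ((n B k : ℕ) → 2 ≤ k → 1 ≤ B → k * B ≤ n → (i : Fin n) →
    (c *ℚ logRatioOverB n B ≤ℚ expectedError n B k i)
    × (expectedError n B k i ≤ℚ C *ℚ logRatioOverB n B))
theorem5 = c₀ , ι 10 , from-yes (0ℚ ℚ.<? c₀) , from-yes (0ℚ ℚ.<? ι 10) , bounds
  where
  bounds : (n B k : ℕ) → 2 ≤ k → 1 ≤ B → k * B ≤ n → (i : Fin n) →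
           (c₀ *ℚ logRatioOverB n B ≤ℚ expectedError n B k i) × (expectedError n B k i ≤ℚ ι 10 *ℚ logRatioOverB n B)
  bounds n (suc b) k 2≤k 1≤B kB≤n i =
    subst (λ x → (c₀ *ℚ x ≤ℚ expectedError n (suc b) k i) × (expectedError n (suc b) k i ≤ℚ ι 10 *ℚ x))
      (sym (/≡ι*recip ⌊log₂ n ℕ./ suc b ⌋ b))
      (lower-bound 2≤k kB≤n i , upper-bound {n} {suc b} {k} kB≤n 2≤k i)
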